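{- For every integer $k\ge 3$, there exist $k$-graphs $F_1$ and $F_2$ such that \[0<\gamma(\{F_1,F_2\})<\min\{\gamma(F_1),\gamma(F_2)\}.\]
   Context: A $k$-graph ($k$-uniform hypergraph) $H$ consists of a vertex set $V(H)$ and an edge set $E(H)\subseteq\binom{V(H)}{k}$. For a $(k-1)$-subset $S\subseteq V(H)$, $d_H(S)$ is the number of edges of $H$ containing $S$. The minimum codegree $\delta_{k-1}(H)$ is the minimum of $d_H(S)$ over all $(k-1)$-subsets $S$ of $V(H)$. For a family $\mathcal{F}$ of $k$-graphs, a $k$-graph is $\mathcal{F}$-free if it contains no member of $\mathcal{F}$ as a (not necessarily induced) subgraph. The codegree Turán number $\mathrm{co\text{ - }ex}(n,\mathcal{F})$ is the maximum of $\delta_{k-1}(H)$ over all $n$-vertex $\mathcal{F}$-free $k$-graphs $H$, and the codegree Turán density is $\gamma(\mathcal{F})=\lim_{n\to\infty}\mathrm{co\text{ - }ex}(n,\mathcal{F})/n$ (this limit is known to exist). For a single $k$-graph $F$, $\gamma(F)=\gamma(\{F\})$. -}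

module Defs where

open import Data.Nat using (ℕ; zero; suc; _+_; _*_; _∸_; _≤_; _<_)
open import Data.Bool using (Bool; true; false; T; if_then_else_)
open import Data.Fin using (Fin)
open import Data.Fin.Subset using (Subset; ⁅_⁆; _∪_; _⊆_; ∣_∣; ⊥)
open import Data.Fin.Subset.Properties using (_⊆?_)
open import Data.Vec using (_∷_; []; lookup)
open import Data.List using (List; map; _++_; filter; foldr; allFin; length; [_])
open import Data.Product using (Σ; _×_; ∃; ∃-syntax; _,_; proj₂)
open import Data.List.Membership.Propositional using (_∈_)
open import Relation.Nullary using (¬_)
open import Relation.Nullary.Decidable using (_×-dec_)
open import Relation.Binary.PropositionalEquality using (_≡_)
open import Function.Definitions using (Injective)
open import Data.Bool.Properties using (T?)

record KGraph (k n : ℕ) : Set where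
  field
    edge    : Subset n → Bool
    uniform : (e : Subset n) → T (edge e) → ∣ e ∣ ≡ k
open KGraph public

AnyKGraph : ℕ → Set
AnyKGraph k = Σ ℕ (λ m → KGraph k m)

allSubsets : (n : ℕ) → List (Subset n)
allSubsets zero    = [ [] ]
allSubsets (suc n) = map (true ∷_) (allSubsets n) ++ map (false ∷_) (allSubsets n)

codeg : ∀ {k n} → KGraph k n → Subset n → ℕ
codeg {k} {n} H S =
  length (filter (λ e → T? (edge H e) ×-dec (S ⊆? e)) (allSubsets n))

MinCodegAtLeast : ∀ {k n} → KGraph k n → ℕ → Set
MinCodegAtLeast {k} {n} H m = (S : Subset n) → ∣ S ∣ ≡ k ∸ 1 → m ≤ codeg H S

-- "δ_{k-1}(H) ≤ m": some (k-1)-subset has codegree at most m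
-- (the minimum over an empty set is +∞, so this fails when there is no such S)
MinCodegAtMost : ∀ {k n} → KGraph k n → ℕ → Set
MinCodegAtMost {k} {n} H m = ∃[ S ] (∣ S ∣ ≡ k ∸ 1 × codeg H S ≤ m)

image : ∀ {m n} → (Fin m → Fin n) → Subset m → Subset n
image {m} f s = foldr (λ i acc → if lookup s i then ⁅ f i ⁆ ∪ acc else acc) ⊥ (allFin m)

Contains : ∀ {k n m} → KGraph k n → KGraph k m → Set
Contains {k} {n} {m} H F =
  ∃[ f ] (Injective _≡_ _≡_ f ×
          ((e : Subset m) → T (edge F e) → T (edge H (image f e))))

Free : ∀ {k n} → KGraph k n → List (AnyKGraph k) → Set
Free {k} {n} H Fs = (F : AnyKGraph k) → F ∈ Fs → ¬ Contains H (proj₂ F)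

-- Rational rates are written as fractions a/b of naturals (b > 0 is imposed
-- where used).  Since the limit γ(F) = lim co-ex(n,F)/n exists, comparisons of
-- codegree Turán densities with rationals are expressed by eventual bounds:

EventuallyCoexAtLeast : (k : ℕ) → List (AnyKGraph k) → ℕ → ℕ → Set
EventuallyCoexAtLeast k Fs a b =
  ∃[ N ] ((n : ℕ) → N ≤ n →
    ∃[ H ] (Free {k} {n} H Fs ×
      ((S : Subset n) → ∣ S ∣ ≡ k ∸ 1 → a * n ≤ b * codeg H S)))

EventuallyCoexAtMost : (k : ℕ) → List (AnyKGraph k) → ℕ → ℕ → Set
EventuallyCoexAtMost k Fs a b =
  ∃[ N ] ((n : ℕ) → N ≤ n → (H : KGraph k n) → Free H Fs →
    ∃[ S ] (∣ S ∣ ≡ k ∸ 1 × b * codeg H S ≤ a * n))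

{-# OPTIONS --safe #-}

-- Let κ = k - 1. The κ-tuples of vertices of a k-graph form a digraph, with an arc u → v if u ∪ {x}
-- is an edge for all x ∈ v. For ℓ = 2, 3 let D_ℓ be a path u → v₁ → ⋯ → v_{ℓ+1} together with the
-- chord u → v_{ℓ+1}, and let G_ℓ consist of a root set and a copy of D_ℓ issuing from each κ-subset
-- u of it.
--
-- Lower bounds. Colour the vertices cyclically with p colours, and take as edges the k-sets for which
-- k - 1 vertices of colour i always leave a vertex of colour i + 1. The codegrees are about n / p.
-- Some κ-subset of the root set of a copy of G_ℓ is monochromatic, and from there on the colour
-- advances by one along each arc; the path and the chord then force p ∣ ℓ. So p = 3 excludes G₂,
-- p = 2 excludes G₃ and p = 4 excludes both.
--
-- Upper bound. Suppose that all codegrees exceed 3n/10 and that G₂ and G₃ are absent. By Ramsey's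
-- theorem every large set of vertices contains a tuple from which neither D₂ nor D₃ issues. Along a
-- path of such tuples, those at distance 2 or 3 have almost disjoint neighbourhoods. Among any four
-- neighbourhoods two have a large intersection, in which the path can be continued from two of its
-- tuples at once, so that later tuples are reached by paths of several lengths. A few such steps
-- yield four almost disjoint neighbourhoods, a contradiction.

module Submission where

open import Defs
open import Level using (0ℓ)
open import Algebra.Properties.CommutativeSemigroup using (interchange; xy∙z≈y∙xz)
open import Data.Bool using (Bool; true; false; T; if_then_else_; _∧_)
open import Data.Bool.Properties using (T?)
import Data.Bool.Properties as Bool
open import Data.Empty using (⊥; ⊥-elim)
open import Data.Fin as Fin using (Fin; zero; suc; toℕ; #_)
import Data.Fin.Properties as Fin
open import Data.Fin.Subset as Subset using (Subset; ⁅_⁆; _∪_; _⊆_; ∣_∣; inside; outside; _∈_; _∉_)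
open import Data.Fin.Subset.Properties as Subset using (_∈?_; _⊆?_)
open import Data.List as List using (List; []; _∷_; length; filter; allFin; foldr)
import Data.List.Properties as List
import Data.List.Membership.DecPropositional as DecMem
open import Data.List.Membership.Propositional using () renaming (_∈_ to _∈ₗ_; _∉_ to _∉ₗ_)
import Data.List.Membership.Propositional.Properties as Mem
open import Data.List.Relation.Unary.All as All using ([]; _∷_)
open import Data.List.Relation.Unary.AllPairs using ([]; _∷_)
open import Data.List.Relation.Unary.Any as Any using (here; there)
import Data.List.Relation.Unary.Any.Properties as Any
open import Data.List.Relation.Unary.Unique.Propositional using () renaming (Unique to Uniqueₗ)
import Data.List.Relation.Unary.Unique.Propositional.Properties as Uniqueₗ
open import Data.Nat as ℕ using (ℕ; zero; suc; _+_; _*_; _≤_; _<_; _≤?_; _<?_; z≤n; s≤s; s≤s⁻¹)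
open import Data.Nat.DivMod
  using (_/_; _mod_; m≡m%n+[m/n]*n; m%n<n; [m+kn]%n≡m%n; m<n⇒m%n≡m; /-monoˡ-≤; m*n/n≡m)
open import Data.Nat.Properties hiding (_≤?_; _<?_)
open import Data.Nat.Tactic.RingSolver using (solve-∀)
open import Data.Product
open import Data.Product.Function.NonDependent.Propositional using (_×-↔_)
open import Data.Sum as Sum using (_⊎_; inj₁; inj₂)
open import Data.Sum.Function.Propositional using (_⊎-↔_)
open import Data.Unit using (⊤)
open import Data.Vec as Vec using (Vec; []; _∷_; toList; lookup)
import Data.Vec.Properties as Vec
import Data.Vec.Membership.Propositional.Properties as VMem
open import Data.Vec.Relation.Unary.All as VAll using ([]; _∷_) renaming (All to Allᵥ)
import Data.Vec.Relation.Unary.All.Properties as VAll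
open import Data.Vec.Relation.Unary.AllPairs using ([]; _∷_) renaming (AllPairs to AllPairsᵥ)
open import Data.Vec.Relation.Unary.Unique.Propositional using (Unique)
import Data.Vec.Relation.Unary.Unique.Propositional.Properties as Unique
open import Effect.Monad using (RawMonad)
open import Function using (_∘_; id; case_of_)
open import Function.Bundles using (_↔_; Inverse; Equivalence)
open import Function.Construct.Composition using (_↔-∘_)
open import Function.Construct.Identity using (↔-id)
open import Relation.Binary.Definitions using (tri<; tri≈; tri>)
open import Relation.Binary.PropositionalEquality hiding ([_])
open import Relation.Nullary
open import Relation.Nullary.Decidable
  using (⌊_⌋; toWitness; fromWitness; _×-dec_; _→-dec_; ¬?; from-yes; decidable-stable)
open import Relation.Nullary.Negation using (¬¬-Monad)
open import Relation.Unary using (Pred)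
import Relation.Unary as U

open RawMonad (¬¬-Monad {0ℓ}) using (_>>=_; _<$>_; pure)

-- Subsequences of vectors

infix 4 _⊏_
data _⊏_ {A : Set} : ∀ {r n} → Vec A r → Vec A n → Set where
  []   : [] ⊏ []
  _∷_  : ∀ {r n} x {xs : Vec A r} {ys : Vec A n} → xs ⊏ ys → x ∷ xs ⊏ x ∷ ys
  _∷ʳ_ : ∀ {r n} y {xs : Vec A r} {ys : Vec A n} → xs ⊏ ys → xs ⊏ y ∷ ys

module _ {A : Set} where

  ⊏-trans : ∀ {l m n} {xs : Vec A l} {ys : Vec A m} {zs : Vec A n} →
            xs ⊏ ys → ys ⊏ zs → xs ⊏ zs
  ⊏-trans p        (y ∷ʳ q)  = y ∷ʳ ⊏-trans p q
  ⊏-trans []       []        = []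
  ⊏-trans (_ ∷ p)  (x ∷ q)   = x ∷ ⊏-trans p q
  ⊏-trans (_ ∷ʳ p) (x ∷ q)   = x ∷ʳ ⊏-trans p q

  []-⊏ : ∀ {n} (xs : Vec A n) → [] ⊏ xs
  []-⊏ []       = []
  []-⊏ (x ∷ xs) = x ∷ʳ []-⊏ xs

  ⊏-prefix : ∀ {s n} → s ≤ n → (xs : Vec A n) → ∃ λ (ys : Vec A s) → ys ⊏ xs
  ⊏-prefix z≤n       xs       = [] , []-⊏ xs
  ⊏-prefix (s≤s s≤n) (x ∷ xs) = map (x ∷_) (x ∷_) (⊏-prefix s≤n xs)

  ⊏-All : ∀ {r n} {P : Pred A 0ℓ} {xs : Vec A r} {ys : Vec A n} → xs ⊏ ys → Allᵥ P ys → Allᵥ P xs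
  ⊏-All []       []        = []
  ⊏-All (_ ∷ p)  (px ∷ ps) = px ∷ ⊏-All p ps
  ⊏-All (_ ∷ʳ p) (_ ∷ ps)  = ⊏-All p ps

  ⊏-Unique : ∀ {r n} {xs : Vec A r} {ys : Vec A n} → xs ⊏ ys → Unique ys → Unique xs
  ⊏-Unique []       []        = []
  ⊏-Unique (_ ∷ p)  (px ∷ ps) = ⊏-All p px ∷ ⊏-Unique p ps
  ⊏-Unique (_ ∷ʳ p) (_ ∷ ps)  = ⊏-Unique p ps

  choose : ∀ r {n} → Vec A n → List (Vec A r)
  choose zero    _        = List.[ [] ]
  choose (suc r) []       = []
  choose (suc r) (x ∷ xs) = List.map (x ∷_) (choose r xs) List.++ choose (suc r) xs

  ⊏⇒∈choose : ∀ {r n} {xs : Vec A r} {ys : Vec A n} → xs ⊏ ys → xs ∈ₗ choose r ys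
  ⊏⇒∈choose {zero}  {xs = []} p  = here refl
  ⊏⇒∈choose {suc r} (x ∷ p)      = Mem.∈-++⁺ˡ (Mem.∈-map⁺ (x ∷_) (⊏⇒∈choose p))
  ⊏⇒∈choose {suc r} {ys = y ∷ ys} (y ∷ʳ p) =
    Mem.∈-++⁺ʳ (List.map (y ∷_) (choose r ys)) (⊏⇒∈choose p)

  ∈choose⇒⊏ : ∀ {r n} {xs : Vec A r} (ys : Vec A n) → xs ∈ₗ choose r ys → xs ⊏ ys
  ∈choose⇒⊏ {zero}  ys       (here refl) = []-⊏ ys
  ∈choose⇒⊏ {suc r} (y ∷ ys) p with Mem.∈-++⁻ (List.map (y ∷_) (choose r ys)) p
  ... | inj₂ q = y ∷ʳ ∈choose⇒⊏ ys q
  ... | inj₁ q with _ , q′ , refl ← Mem.∈-map⁻ (y ∷_) q = y ∷ ∈choose⇒⊏ ys q′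

⊏-map : ∀ {A B : Set} (f : A → B) {r n} {xs : Vec A r} {ys : Vec A n} →
        xs ⊏ ys → Vec.map f xs ⊏ Vec.map f ys
⊏-map f []       = []
⊏-map f (x ∷ p)  = f x ∷ ⊏-map f p
⊏-map f (y ∷ʳ p) = f y ∷ʳ ⊏-map f p

-- Ramsey's theorem

-- For `r = 0` the single empty tuple decides the colour, and `s + t` entries suffice for either
-- one. In the recursion, the two inner numbers are the sizes with which the search can continue
-- once the head is known to prefer one of the colours.
ramseyNumber : ℕ → ℕ → ℕ → ℕ
ramseyNumber zero    s       t       = s + t
ramseyNumber (suc r) zero    t       = 0
ramseyNumber (suc r) (suc s) zero    = 0
ramseyNumber (suc r) (suc s) (suc t) =
  suc (ramseyNumber r (ramseyNumber (suc r) s (suc t)) (ramseyNumber (suc r) (suc s) t))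

module _ {A : Set} where

  HomogeneousSub : ∀ {r n} → ℕ → (Vec A r → Set) → Vec A n → Set
  HomogeneousSub {r} s P xs =
    ∃ λ (ys : Vec A s) → ys ⊏ xs × (∀ (zs : Vec A r) → zs ⊏ ys → P zs)

  homogeneous-∷ : ∀ {r s m n} {P : Vec A (suc r) → Set} x {xs : Vec A n} {ys : Vec A m} → ys ⊏ xs →
                  (∀ zs → zs ⊏ ys → P (x ∷ zs)) →
                  HomogeneousSub s P ys → HomogeneousSub (suc s) P (x ∷ xs)
  homogeneous-∷ x ys⊏xs Px (us , us⊏ys , Pus) = x ∷ us , x ∷ ⊏-trans us⊏ys ys⊏xs , λ where
    _ (_ ∷ p)  → Px _ (⊏-trans p us⊏ys)
    _ (_ ∷ʳ p) → Pus _ p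

  homogeneous-mono : ∀ {r s m n} {P : Vec A r → Set} x {xs : Vec A n} {ys : Vec A m} → ys ⊏ xs →
                     HomogeneousSub s P ys → HomogeneousSub s P (x ∷ xs)
  homogeneous-mono x ys⊏xs (us , us⊏ys , Pus) = us , x ∷ʳ ⊏-trans us⊏ys ys⊏xs , Pus

  -- Double negated because the properties P and Q it is applied to are not decided.
  ramsey : ∀ r s t {n} → ramseyNumber r s t ≤ n → (xs : Vec A n) (P Q : Vec A r → Set) →
           (∀ zs → zs ⊏ xs → ¬ ¬ (P zs ⊎ Q zs)) →
           ¬ ¬ (HomogeneousSub s P xs ⊎ HomogeneousSub t Q xs)
  ramsey zero s t le xs P Q col = col [] ([]-⊏ xs) >>= λ where
    (inj₁ p) → pure (inj₁ (map₂ (λ ys⊏ → ys⊏ , λ { [] _ → p }) (⊏-prefix (≤-trans (m≤m+n s t) le) xs)))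
    (inj₂ q) → pure (inj₂ (map₂ (λ ys⊏ → ys⊏ , λ { [] _ → q }) (⊏-prefix (≤-trans (m≤n+m t s) le) xs)))
  ramsey (suc r) zero t le xs P Q col = pure (inj₁ ([] , []-⊏ xs , λ _ ()))
  ramsey (suc r) (suc s) zero le xs P Q col = pure (inj₂ ([] , []-⊏ xs , λ _ ()))
  ramsey (suc r) (suc s) (suc t) (s≤s le) (x ∷ xs) P Q col =
    -- Colour an `r`-tuple of the tail by the colour it gets with `x` in front. In a homogeneous
    -- `ys` for this colouring, a set of the same colour can be enlarged by `x`, and a set of the
    -- other colour already has the full size.
    ramsey r _ _ le xs (P ∘ (x ∷_)) (Q ∘ (x ∷_)) (λ zs p → col (x ∷ zs) (x ∷ p)) >>=
    Sum.[ (λ (ys , ys⊏xs , Pys) →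
            Sum.map (homogeneous-∷ x ys⊏xs Pys) (homogeneous-mono x ys⊏xs) <$>
            ramsey (suc r) s (suc t) ≤-refl ys P Q (λ zs p → col zs (x ∷ʳ ⊏-trans p ys⊏xs)))
        , (λ (ys , ys⊏xs , Qys) →
            Sum.map (homogeneous-mono x ys⊏xs) (homogeneous-∷ x ys⊏xs Qys) <$>
            ramsey (suc r) (suc s) t ≤-refl ys P Q (λ zs p → col zs (x ∷ʳ ⊏-trans p ys⊏xs)))
        ]

-- Pigeonhole principles

splitᵥ : ∀ {A : Set} {P : Pred A 0ℓ} → U.Decidable P → ∀ {n} (xs : Vec A n) →
         ∃₂ λ a b → a + b ≡ n × (∃ λ (ys : Vec A a) → ys ⊏ xs × Allᵥ P ys) ×
                    (∃ λ (zs : Vec A b) → zs ⊏ xs × Allᵥ (U.∁ P) zs)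
splitᵥ P? [] = 0 , 0 , refl , ([] , [] , []) , ([] , [] , [])
splitᵥ P? (x ∷ xs) with splitᵥ P? xs | P? x
... | a , b , eq , (ys , p , Pys) , (zs , q , ¬Pzs) | yes Px =
  suc a , b , cong suc eq , (x ∷ ys , x ∷ p , Px ∷ Pys) , (zs , x ∷ʳ q , ¬Pzs)
... | a , b , eq , (ys , p , Pys) , (zs , q , ¬Pzs) | no ¬Px =
  a , suc b , trans (+-suc a b) (cong suc eq) , (ys , x ∷ʳ p , Pys) , (x ∷ zs , x ∷ q , ¬Px ∷ ¬Pzs)

-- Induction on the number of colours: either the last colour class has `κ` entries, or fewer than
-- `κ` entries are lost by discarding it and the rest uses one colour less.
monochromaticSub : ∀ {A : Set} p κ {n} (xs : Vec A n) (f : A → ℕ) → Allᵥ (λ x → f x < p) xs →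
                   p * κ < n → ∃ λ c → c < p × ∃ λ (zs : Vec A κ) → zs ⊏ xs × Allᵥ (λ x → f x ≡ c) zs
monochromaticSub zero    κ (x ∷ xs) f (() ∷ _) lt
monochromaticSub (suc p) κ xs f f<p lt with splitᵥ (λ x → f x ℕ.≟ p) xs
... | a , b , refl , (ys , ys⊏ , Pys) , (zs , zs⊏ , ¬Pzs) with κ ℕ.≤? a
...   | yes κ≤a = let us , us⊏ = ⊏-prefix κ≤a ys in p , n<1+n p , us , ⊏-trans us⊏ ys⊏ , ⊏-All us⊏ Pys
...   | no  κ≰a =
  let c , c<p , us , us⊏ , eqs = monochromaticSub p κ zs f
        (VAll.map (λ (f≢p , f<1+p) → ≤∧≢⇒< (s≤s⁻¹ f<1+p) f≢p) (VAll.zip (¬Pzs , ⊏-All zs⊏ f<p)))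
        (+-cancelˡ-< κ _ _ (≤-trans lt (+-monoˡ-≤ b (<⇒≤ (≰⇒> κ≰a)))))
  in c , m<n⇒m<1+n c<p , us , ⊏-trans us⊏ zs⊏ , eqs

fromList-unique : ∀ {A : Set} {xs : List A} → Uniqueₗ xs → Unique (Vec.fromList xs)
fromList-unique []       = []
fromList-unique (x∉ ∷ u) = VAll.fromList⁺ x∉ ∷ fromList-unique u

lookup-AllPairs : ∀ {A : Set} {_~_ : A → A → Set} {n} {xs : Vec A n} → AllPairsᵥ _~_ xs →
                  ∀ {i j} → i Fin.< j → lookup xs i ~ lookup xs j
lookup-AllPairs (px ∷ pxs) {zero}  {suc j} (s≤s _) = VAll.lookup⁺ px j
lookup-AllPairs (px ∷ pxs) {suc i} {suc j} (s≤s i<j) = lookup-AllPairs pxs i<j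

length-concatMap≤ : ∀ {A B : Set} (f : A → List B) l → (∀ x → length (f x) ≤ l) →
                    ∀ xs → length (List.concatMap f xs) ≤ length xs * l
length-concatMap≤ f l f≤ []       = z≤n
length-concatMap≤ f l f≤ (x ∷ xs) =
  ≤-trans (≤-reflexive (List.length-++ (f x))) (+-mono-≤ (f≤ x) (length-concatMap≤ f l f≤ xs))

-- The head is cut out of `ys` at a place where it occurs. Uniqueness ensures that the tail survives
-- the cut.
unique-⊆⇒length≤ : ∀ {A : Set} {xs ys : List A} → Uniqueₗ xs → (∀ {x} → x ∈ₗ xs → x ∈ₗ ys) →
                   length xs ≤ length ys
unique-⊆⇒length≤ [] sub = z≤n
unique-⊆⇒length≤ {xs = x ∷ xs} (x∉xs ∷ u) sub
  with as , bs , refl ← Mem.∈-∃++ (sub (here refl)) = begin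
    suc (length xs)              ≤⟨ s≤s (unique-⊆⇒length≤ u sub′) ⟩
    suc (length (as List.++ bs)) ≡⟨ cong suc (List.length-++ as) ⟩
    suc (length as + length bs)  ≡⟨ +-suc (length as) (length bs) ⟨
    length as + suc (length bs)  ≡⟨ List.length-++ as ⟨
    length (as List.++ x ∷ bs)   ∎
  where
  open ≤-Reasoning
  sub′ : ∀ {z} → z ∈ₗ xs → z ∈ₗ as List.++ bs
  sub′ z∈xs with Mem.∈-++⁻ as (sub (there z∈xs))
  ... | inj₁ z∈as         = Mem.∈-++⁺ˡ z∈as
  ... | inj₂ (here refl)  = contradiction refl (All.lookup x∉xs z∈xs)
  ... | inj₂ (there z∈bs) = Mem.∈-++⁺ʳ as z∈bs

-- Tuples of vertices as sets

module _ {n : ℕ} where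

  ⟪_⟫ : ∀ {m} → Vec (Fin n) m → Subset n
  ⟪ []     ⟫ = Subset.⊥
  ⟪ v ∷ vs ⟫ = ⁅ v ⁆ ∪ ⟪ vs ⟫

  ∈-insert⁻ : ∀ {x v} {p : Subset n} → x ∈ ⁅ v ⁆ ∪ p → x ≡ v ⊎ x ∈ p
  ∈-insert⁻ {v = v} {p} x∈ = Sum.map₁ (Subset.x∈⁅y⁆⇒x≡y v) (Subset.x∈p∪q⁻ ⁅ v ⁆ p x∈)

  ∈-insert-here : ∀ {v} {p : Subset n} → v ∈ ⁅ v ⁆ ∪ p
  ∈-insert-here {v} {p} = Subset.p⊆p∪q p (Subset.x∈⁅x⁆ v)

  ∈-insert-there : ∀ {x v} {p : Subset n} → x ∈ p → x ∈ ⁅ v ⁆ ∪ p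
  ∈-insert-there {v = v} {p} = Subset.q⊆p∪q ⁅ v ⁆ p

  lookup∈⟪⟫ : ∀ {m} (vs : Vec (Fin n) m) i → lookup vs i ∈ ⟪ vs ⟫
  lookup∈⟪⟫ (v ∷ vs) zero    = ∈-insert-here
  lookup∈⟪⟫ (v ∷ vs) (suc i) = ∈-insert-there (lookup∈⟪⟫ vs i)

  ∈⟪⟫⁻ : ∀ {m x} (vs : Vec (Fin n) m) → x ∈ ⟪ vs ⟫ → ∃ λ i → lookup vs i ≡ x
  ∈⟪⟫⁻ []       x∈ = contradiction x∈ Subset.∉⊥
  ∈⟪⟫⁻ (v ∷ vs) x∈ with ∈-insert⁻ x∈
  ... | inj₁ refl = zero , refl
  ... | inj₂ x∈vs = map suc id (∈⟪⟫⁻ vs x∈vs)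

∣insert∣ : ∀ {n} {v} (p : Subset n) → v ∉ p → ∣ ⁅ v ⁆ ∪ p ∣ ≡ suc ∣ p ∣
∣insert∣ {v = zero}  (inside  ∷ p) v∉p = contradiction Vec.here v∉p
∣insert∣ {v = zero}  (outside ∷ p) v∉p = cong (suc ∘ ∣_∣) (Subset.∪-identityˡ p)
∣insert∣ {v = suc v} (inside  ∷ p) v∉p = cong suc (∣insert∣ p (v∉p ∘ Vec.there))
∣insert∣ {v = suc v} (outside ∷ p) v∉p = ∣insert∣ p (v∉p ∘ Vec.there)

⊆∧∣≡∣⇒≡ : ∀ {n} (p q : Subset n) → p ⊆ q → ∣ q ∣ ≡ ∣ p ∣ → q ≡ p
⊆∧∣≡∣⇒≡ []            []            p⊆q eq = refl
⊆∧∣≡∣⇒≡ (inside  ∷ p) (inside  ∷ q) p⊆q eq =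
  cong (inside ∷_) (⊆∧∣≡∣⇒≡ p q (Subset.drop-∷-⊆ p⊆q) (suc-injective eq))
⊆∧∣≡∣⇒≡ (inside  ∷ p) (outside ∷ q) p⊆q eq with () ← p⊆q Vec.here
⊆∧∣≡∣⇒≡ (outside ∷ p) (inside  ∷ q) p⊆q eq =
  contradiction (≤-reflexive eq) (≤⇒≯ (Subset.p⊆q⇒∣p∣≤∣q∣ (Subset.drop-∷-⊆ p⊆q)))
⊆∧∣≡∣⇒≡ (outside ∷ p) (outside ∷ q) p⊆q eq =
  cong (outside ∷_) (⊆∧∣≡∣⇒≡ p q (Subset.drop-∷-⊆ p⊆q) eq)

⊆⇒insert : ∀ {n} (p q : Subset n) → p ⊆ q → ∣ q ∣ ≡ suc ∣ p ∣ → ∃ λ v → q ≡ ⁅ v ⁆ ∪ p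
⊆⇒insert (inside  ∷ p) (inside  ∷ q) p⊆q eq =
  map suc (cong (inside ∷_)) (⊆⇒insert p q (Subset.drop-∷-⊆ p⊆q) (suc-injective eq))
⊆⇒insert (inside  ∷ p) (outside ∷ q) p⊆q eq with () ← p⊆q Vec.here
⊆⇒insert (outside ∷ p) (inside  ∷ q) p⊆q eq = zero , cong (inside ∷_)
  (trans (⊆∧∣≡∣⇒≡ p q (Subset.drop-∷-⊆ p⊆q) (suc-injective eq)) (sym (Subset.∪-identityˡ p)))
⊆⇒insert (outside ∷ p) (outside ∷ q) p⊆q eq =
  map suc (cong (outside ∷_)) (⊆⇒insert p q (Subset.drop-∷-⊆ p⊆q) eq)

∣⟪⟫∣ : ∀ {n m} {vs : Vec (Fin n) m} → Unique vs → ∣ ⟪ vs ⟫ ∣ ≡ m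
∣⟪⟫∣ {n} {vs = []}     []        = Subset.∣⊥∣≡0 n
∣⟪⟫∣     {vs = v ∷ vs} (v∉ ∷ u) = trans (∣insert∣ ⟪ vs ⟫ v∉⟪vs⟫) (cong suc (∣⟪⟫∣ u))
  where
  v∉⟪vs⟫ : v ∉ ⟪ vs ⟫
  v∉⟪vs⟫ v∈ with i , eq ← ∈⟪⟫⁻ vs v∈ = VAll.lookup⁺ v∉ i (sym eq)

elements : ∀ {n} → Subset n → List (Fin n)
elements []            = []
elements (inside  ∷ S) = zero ∷ List.map suc (elements S)
elements (outside ∷ S) = List.map suc (elements S)

∈⇒∈elements : ∀ {n x} {S : Subset n} → x ∈ S → x ∈ₗ elements S
∈⇒∈elements {S = inside  ∷ S} Vec.here      = here refl
∈⇒∈elements {S = inside  ∷ S} (Vec.there p) = there (Mem.∈-map⁺ suc (∈⇒∈elements p))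
∈⇒∈elements {S = outside ∷ S} (Vec.there p) = Mem.∈-map⁺ suc (∈⇒∈elements p)

length-elements : ∀ {n} (S : Subset n) → length (elements S) ≡ ∣ S ∣
length-elements []            = refl
length-elements (inside  ∷ S) = cong suc (trans (List.length-map suc (elements S)) (length-elements S))
length-elements (outside ∷ S) = trans (List.length-map suc (elements S)) (length-elements S)

-- Codegrees

∈allSubsets : ∀ {n} (p : Subset n) → p ∈ₗ allSubsets n
∈allSubsets []            = here refl
∈allSubsets (inside  ∷ p) = Mem.∈-++⁺ˡ (Mem.∈-map⁺ (inside ∷_) (∈allSubsets p))
∈allSubsets (outside ∷ p) =
  Mem.∈-++⁺ʳ (List.map (inside ∷_) (allSubsets _)) (Mem.∈-map⁺ (outside ∷_) (∈allSubsets p))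

allSubsets-unique : ∀ n → Uniqueₗ (allSubsets n)
allSubsets-unique zero    = All.[] ∷ []
allSubsets-unique (suc n) =
  Uniqueₗ.++⁺ (Uniqueₗ.map⁺ Vec.∷-injectiveʳ (allSubsets-unique n))
              (Uniqueₗ.map⁺ Vec.∷-injectiveʳ (allSubsets-unique n))
              λ (p , q) → case (Mem.∈-map⁻ _ p) (Mem.∈-map⁻ _ q)
  where
  case : ∀ {p} → ∃ (λ q → q ∈ₗ allSubsets n × p ≡ inside ∷ q) →
         ∃ (λ q → q ∈ₗ allSubsets n × p ≡ outside ∷ q) → ⊥
  case (_ , _ , refl) ()

module _ {κ n : ℕ} (H : KGraph (suc κ) n) (S : Subset n) where

  extending : List (Fin n)
  extending = filter (λ v → T? (edge H (⁅ v ⁆ ∪ S))) (allFin n)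

  -- By uniformity an edge containing `S` is `S` with one more vertex, so counting vertices accounts
  -- for all edges.
  codeg≤∣extending∣ : ∣ S ∣ ≡ κ → codeg H S ≤ length extending
  codeg≤∣extending∣ ∣S∣≡κ = subst (codeg H S ≤_) (List.length-map (λ v → ⁅ v ⁆ ∪ S) extending)
    (unique-⊆⇒length≤ (Uniqueₗ.filter⁺ _ (allSubsets-unique n)) λ e∈ →
      let _ , eᴴ , S⊆e = Mem.∈-filter⁻ (λ e → T? (edge H e) ×-dec (S ⊆? e)) {xs = allSubsets n} e∈
          v , eq       = ⊆⇒insert S _ S⊆e (trans (uniform H _ eᴴ) (cong suc (sym ∣S∣≡κ)))
      in subst (_∈ₗ _) (sym eq) (Mem.∈-map⁺ _
           (Mem.∈-filter⁺ _ (Mem.∈-allFin v) (subst (T ∘ edge H) eq eᴴ))))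

  length≤codeg : ∀ {vs} → Uniqueₗ vs → (∀ {v} → v ∈ₗ vs → v ∉ S × T (edge H (⁅ v ⁆ ∪ S))) →
                 length vs ≤ codeg H S
  length≤codeg {vs} u ext = subst (_≤ codeg H S) (List.length-map (λ v → ⁅ v ⁆ ∪ S) vs)
    (unique-⊆⇒length≤ (map-unique u ext) λ e∈ →
      let v , v∈ , eq = Mem.∈-map⁻ _ e∈
      in subst (_∈ₗ _) (sym eq) (Mem.∈-filter⁺ _ (∈allSubsets _)
           (proj₂ (ext v∈) , λ {_} → ∈-insert-there)))
    where
    map-unique : ∀ {vs} → Uniqueₗ vs → (∀ {v} → v ∈ₗ vs → v ∉ S × T (edge H (⁅ v ⁆ ∪ S))) →
                 Uniqueₗ (List.map (λ v → ⁅ v ⁆ ∪ S) vs)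
    map-unique []        ext = []
    map-unique (v∉ ∷ u) ext = All.tabulate (λ e∈ eq →
        -- If `v` and `w` gave the same edge, `v` would be `w` or lie in `S`.
        let w , w∈ , eq′ = Mem.∈-map⁻ _ e∈
        in Sum.[ All.lookup v∉ w∈ , proj₁ (ext (here refl)) ]
             (∈-insert⁻ (subst (_ ∈_) (trans eq eq′) ∈-insert-here)))
      ∷ map-unique u (ext ∘ there)

-- Subgraph embeddings

∈image⁻ : ∀ {m n} (f : Fin m → Fin n) (s : Subset m) {x} → x ∈ image f s → ∃ λ i → i ∈ s × f i ≡ x
∈image⁻ {m} {n} f s {x} = go (allFin m)
  where
  go : ∀ is → x ∈ foldr (λ i acc → if lookup s i then ⁅ f i ⁆ ∪ acc else acc) Subset.⊥ is →
       ∃ λ i → i ∈ s × f i ≡ x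
  go []       x∈ = contradiction x∈ Subset.∉⊥
  go (i ∷ is) x∈ with lookup s i in eq
  ... | false = go is x∈
  ... | true  with ∈-insert⁻ x∈
  ...   | inj₁ refl = i , Vec.lookup⇒[]= i s eq , refl
  ...   | inj₂ x∈′  = go is x∈′

∈image⁺ : ∀ {m n} (f : Fin m → Fin n) (s : Subset m) {i} → i ∈ s → f i ∈ image f s
∈image⁺ {m} {n} f s {i} i∈s = go (Mem.∈-allFin i)
  where
  go : ∀ {is} → i ∈ₗ is →
       f i ∈ foldr (λ i acc → if lookup s i then ⁅ f i ⁆ ∪ acc else acc) Subset.⊥ is
  go (here refl) rewrite Vec.[]=⇒lookup i∈s = ∈-insert-here
  go (there {j} i∈is) with lookup s j
  ... | true  = ∈-insert-there (go i∈is)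
  ... | false = go i∈is

image-⟪⟫ : ∀ {m n l} (f : Fin m → Fin n) (vs : Vec (Fin m) l) → image f ⟪ vs ⟫ ≡ ⟪ Vec.map f vs ⟫
image-⟪⟫ f vs = Subset.⊆-antisym to from
  where
  to : image f ⟪ vs ⟫ ⊆ ⟪ Vec.map f vs ⟫
  to x∈ with i , i∈ , refl ← ∈image⁻ f ⟪ vs ⟫ x∈ with j , refl ← ∈⟪⟫⁻ vs i∈ =
    subst (_∈ _) (Vec.lookup-map j f vs) (lookup∈⟪⟫ (Vec.map f vs) j)
  from : ⟪ Vec.map f vs ⟫ ⊆ image f ⟪ vs ⟫
  from x∈ with j , refl ← ∈⟪⟫⁻ (Vec.map f vs) x∈ =
    subst (_∈ _) (sym (Vec.lookup-map j f vs)) (∈image⁺ f ⟪ vs ⟫ (lookup∈⟪⟫ vs j))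

-- k-tuples with repeated entries are discarded.
module _ {k m : ℕ} (L : List (Vec (Fin m) k)) where

  private
    edge? : (e : Subset m) → Dec (∣ e ∣ ≡ k × e ∈ₗ List.map ⟪_⟫ L)
    edge? e = (∣ e ∣ ℕ.≟ k) ×-dec (DecMem._∈?_ (Vec.≡-dec Bool._≟_) e (List.map ⟪_⟫ L))

  fromTuples : KGraph k m
  fromTuples .edge e      = ⌊ edge? e ⌋
  fromTuples .uniform e t = proj₁ (toWitness t)

  ∈⇒edge : ∀ {vs} → Unique vs → vs ∈ₗ L → T (edge fromTuples ⟪ vs ⟫)
  ∈⇒edge u vs∈L = fromWitness (∣⟪⟫∣ u , Mem.∈-map⁺ ⟪_⟫ vs∈L)

  edge⇒∈ : ∀ {e} → T (edge fromTuples e) → ∃ λ vs → vs ∈ₗ L × e ≡ ⟪ vs ⟫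
  edge⇒∈ t = Mem.∈-map⁻ ⟪_⟫ (proj₂ (toWitness t))

-- Digraphs attached to a root set

IsArc : ∀ {k n r s} → KGraph k n → Vec (Fin n) r → Vec (Fin n) s → Set
IsArc H u v = ∀ i → T (edge H ⟪ lookup v i ∷ u ⟫)

-- The index counts the nodes other than node 0, that is, those needing fresh vertices.
Digraph : ℕ → Set
Digraph m = List (Fin (suc m) × Fin (suc m))

-- A copy of D is attached to every κ-subset of a root set of size t: node 0 of D is that
-- subset, every other node is a fresh κ-tuple, and an arc u → v of D becomes the edges u ∪ {x}, x ∈ v.
module Attach (κ t : ℕ) {m : ℕ} (D : Digraph m) where

  roots : List (Vec (Fin t) κ)
  roots = choose κ (Vec.allFin t)

  Vertex : Set
  Vertex = Fin t ⊎ (Fin (length roots) × (Fin m × Fin κ))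

  size : ℕ
  size = t + length roots * (m * κ)

  vertex↔ : Fin size ↔ Vertex
  vertex↔ = (↔-id _ ⊎-↔ ((↔-id _ ×-↔ Fin.*↔×) ↔-∘ Fin.*↔×)) ↔-∘ Fin.+↔⊎

  open Inverse vertex↔ using () renaming (to to decode; from to encode)

  decode-encode : ∀ v → decode (encode v) ≡ v
  decode-encode = Inverse.strictlyInverseˡ vertex↔

  decode-injective : ∀ {x y} → decode x ≡ decode y → x ≡ y
  decode-injective {x} {y} eq =
    trans (sym (Inverse.strictlyInverseʳ vertex↔ x))
      (trans (cong encode eq) (Inverse.strictlyInverseʳ vertex↔ y))

  encode-injective : ∀ {x y} → encode x ≡ encode y → x ≡ y
  encode-injective {x} {y} eq = trans (sym (decode-encode x)) (trans (cong decode eq) (decode-encode y))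

  node : Fin (length roots) → Fin (suc m) → Vec Vertex κ
  node j zero    = Vec.map inj₁ (List.lookup roots j)
  node j (suc i) = Vec.tabulate λ a → inj₂ (j , i , a)

  tuple : Fin (length roots) × (Fin (suc m) × Fin (suc m)) × Fin κ → Vec Vertex (suc κ)
  tuple (j , (a , b) , i) = lookup (node j b) i ∷ node j a

  tuples : List (Vec Vertex (suc κ))
  tuples = List.map tuple
    (List.cartesianProduct (allFin (length roots)) (List.cartesianProduct D (allFin κ)))

  graph : KGraph (suc κ) size
  graph = fromTuples (List.map (Vec.map encode) tuples)

  node-unique : ∀ j a → Unique (node j a)
  node-unique j zero    = Unique.map⁺ (λ { refl → refl })
    (⊏-Unique (∈choose⇒⊏ _ (Mem.∈-lookup j)) (Unique.tabulate⁺ id))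
  node-unique j (suc i) = Unique.tabulate⁺ λ { refl → refl }

  -- Together with `node-unique` this makes the `tuple` of an arc that is not a loop free of
  -- repetitions, so that `fromTuples` keeps it.
  nodes-disjoint : ∀ {j a b} i i′ → lookup (node j a) i ≡ lookup (node j b) i′ → a ≡ b
  nodes-disjoint {j} {zero}  {zero}  i i′ eq = refl
  nodes-disjoint {j} {zero}  {suc b} i i′ eq
    with () ← trans (sym (Vec.lookup-map i inj₁ (List.lookup roots j))) (trans eq (Vec.lookup∘tabulate _ i′))
  nodes-disjoint {j} {suc a} {zero}  i i′ eq
    with () ← trans (sym (Vec.lookup∘tabulate _ i)) (trans eq (Vec.lookup-map i′ inj₁ (List.lookup roots j)))
  nodes-disjoint {j} {suc a} {suc b} i i′ eq
    with refl ← trans (sym (Vec.lookup∘tabulate _ i)) (trans eq (Vec.lookup∘tabulate _ i′)) = refl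

  module _ {n : ℕ} (H : KGraph (suc κ) n) where

    embed : (g : Vertex → Fin n) → (∀ {x y} → g x ≡ g y → x ≡ y) →
            (∀ j {a b} → (a , b) ∈ₗ D → IsArc H (Vec.map g (node j a)) (Vec.map g (node j b))) →
            Contains H graph
    embed g g-inj arcs = g ∘ decode , decode-injective ∘ g-inj , λ e eᶠ →
      let vs , vs∈ , e≡         = edge⇒∈ (List.map (Vec.map encode) tuples) {e} eᶠ
          ws , ws∈ , vs≡        = Mem.∈-map⁻ (Vec.map encode) vs∈
          (j , (a , b) , i) , ∈prod , ws≡ = Mem.∈-map⁻ tuple ws∈
          _ , ∈prod′            = Mem.∈-cartesianProduct⁻ (allFin _) (List.cartesianProduct D (allFin κ)) ∈prod
          ab∈D , _              = Mem.∈-cartesianProduct⁻ D (allFin κ) ∈prod′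
          open ≡-Reasoning
      in subst (T ∘ edge H) (begin
           ⟪ lookup (Vec.map g (node j b)) i ∷ Vec.map g (node j a) ⟫
             ≡⟨ cong (λ x → ⟪ x ∷ Vec.map g (node j a) ⟫) (Vec.lookup-map i g (node j b)) ⟩
           ⟪ Vec.map g (tuple (j , (a , b) , i)) ⟫
             ≡⟨ cong (⟪_⟫ ∘ Vec.map g) ws≡ ⟨
           ⟪ Vec.map g ws ⟫
             ≡⟨ cong ⟪_⟫ (Vec.map-cong (cong g ∘ decode-encode) ws) ⟨
           ⟪ Vec.map (g ∘ decode ∘ encode) ws ⟫
             ≡⟨ cong ⟪_⟫ (Vec.map-∘ (g ∘ decode) encode ws) ⟩
           ⟪ Vec.map (g ∘ decode) (Vec.map encode ws) ⟫
             ≡⟨ cong (⟪_⟫ ∘ Vec.map (g ∘ decode)) vs≡ ⟨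
           ⟪ Vec.map (g ∘ decode) vs ⟫
             ≡⟨ image-⟪⟫ (g ∘ decode) vs ⟨
           image (g ∘ decode) ⟪ vs ⟫
             ≡⟨ cong (image (g ∘ decode)) e≡ ⟨
           image (g ∘ decode) e ∎) (arcs j ab∈D i)

    -- Serves to refute containment. Without loops every `tuple` is a genuine edge, and its image is
    -- the edge of `H` that the arc asks for.
    restrict : (∀ {a b} → (a , b) ∈ₗ D → a ≢ b) → Contains H graph →
               ∃ λ (g : Vertex → Fin n) →
               ∀ j {a b} → (a , b) ∈ₗ D → IsArc H (Vec.map g (node j a)) (Vec.map g (node j b))
    restrict loopless (f , _ , f-edges) = f ∘ encode , λ j {a} {b} ab∈D i →
      let ws    = tuple (j , (a , b) , i)
          ws∈   = Mem.∈-map⁺ tuple (Mem.∈-cartesianProduct⁺ (Mem.∈-allFin j)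
                    (Mem.∈-cartesianProduct⁺ ab∈D (Mem.∈-allFin i)))
          ws-unique : Unique ws
          ws-unique = VAll.lookup⁻ (λ i′ eq → loopless ab∈D (sym (nodes-disjoint i i′ eq)))
                      ∷ node-unique j a
          ws-edge = ∈⇒edge (List.map (Vec.map encode) tuples)
                      (Unique.map⁺ encode-injective ws-unique) (Mem.∈-map⁺ (Vec.map encode) ws∈)
          open ≡-Reasoning
      in subst (T ∘ edge H) (begin
           image f ⟪ Vec.map encode ws ⟫
             ≡⟨ image-⟪⟫ f (Vec.map encode ws) ⟩
           ⟪ Vec.map f (Vec.map encode ws) ⟫
             ≡⟨ cong ⟪_⟫ (Vec.map-∘ f encode ws) ⟨
           ⟪ Vec.map (f ∘ encode) ws ⟫
             ≡⟨ cong (λ x → ⟪ x ∷ Vec.map (f ∘ encode) (node j a) ⟫) (Vec.lookup-map i _ (node j b)) ⟨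
           ⟪ lookup (Vec.map (f ∘ encode) (node j b)) i ∷ Vec.map (f ∘ encode) (node j a) ⟫ ∎)
         (f-edges ⟪ Vec.map encode ws ⟫ ws-edge)

D₂ : Digraph 3
D₂ = (# 0 , # 1) ∷ (# 1 , # 2) ∷ (# 2 , # 3) ∷ (# 0 , # 3) ∷ []

D₃ : Digraph 4
D₃ = (# 0 , # 1) ∷ (# 1 , # 2) ∷ (# 2 , # 3) ∷ (# 3 , # 4) ∷ (# 0 , # 4) ∷ []

-- Cyclic colourings

module Cyclic (p : ℕ) .{{_ : ℕ.NonZero p}} (next prev : Fin p → Fin p)
  (next-prev : ∀ c → next (prev c) ≡ c) (next≢ : ∀ c → next c ≢ c) where

  colour : ∀ {n} → Fin n → Fin p
  colour v = toℕ v mod p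

  Cyclic : ∀ {n} → Subset n → Set
  Cyclic e = ∀ u → u ∈ e → ∀ c → (∀ w → w ∈ e → w ≢ u → colour w ≡ c) → colour u ≡ next c

  cyclic? : ∀ {n} (e : Subset n) → Dec (Cyclic e)
  cyclic? e = Fin.all? λ u → (u ∈? e) →-dec Fin.all? λ c →
    Fin.all? (λ w → (w ∈? e) →-dec ¬? (w Fin.≟ u) →-dec (colour w Fin.≟ c)) →-dec
    (colour u Fin.≟ next c)

  cyclicGraph : ∀ κ n → KGraph (suc κ) n
  cyclicGraph κ n .edge e      = ⌊ (∣ e ∣ ℕ.≟ suc κ) ×-dec cyclic? e ⌋
  cyclicGraph κ n .uniform e t = proj₁ (toWitness t)

  Monochromatic : ∀ {n r} → Fin p → Vec (Fin n) r → Set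
  Monochromatic c u = ∀ i → colour (lookup u i) ≡ c

  -- In the edge formed by `u` and an entry of `v`, all vertices other than this entry lie in `u`
  -- and have colour `c`, so the entry must have the next colour.
  arc-colour : ∀ {κ n r s c} (u : Vec (Fin n) r) (v : Vec (Fin n) s) →
               IsArc (cyclicGraph κ n) u v → Monochromatic c u → Monochromatic (next c) v
  arc-colour {c = c} u v arc mono i = proj₂ (toWitness (arc i)) _ ∈-insert-here c λ w w∈ w≢ →
    Sum.[ (λ w≡ → contradiction w≡ w≢)
        , (λ w∈u → let j , eq = ∈⟪⟫⁻ u w∈u in trans (cong colour (sym eq)) (mono j)) ]
      (∈-insert⁻ w∈)

  module _ {κ n : ℕ} (2≤κ : 2 ≤ κ) (S : Subset n) (∣S∣≡κ : ∣ S ∣ ≡ κ) where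

    private
      H = cyclicGraph κ n

    another : ∀ u → ∃ λ w → w ∈ S × w ≢ u
    another u with Fin.any? (λ w → (w ∈? S) ×-dec ¬? (w Fin.≟ u))
    ... | yes p = p
    ... | no ¬p = contradiction (≤-trans 2≤κ (begin
          κ         ≡⟨ ∣S∣≡κ ⟨
          ∣ S ∣     ≤⟨ Subset.p⊆q⇒∣p∣≤∣q∣ S⊆⁅u⁆ ⟩
          ∣ ⁅ u ⁆ ∣ ≡⟨ Subset.∣⁅x⁆∣≡1 u ⟩
          1         ∎)) λ { (s≤s ()) }
      where
      open ≤-Reasoning
      S⊆⁅u⁆ : S ⊆ ⁅ u ⁆
      S⊆⁅u⁆ {w} w∈S with w Fin.≟ u
      ... | yes refl = Subset.x∈⁅x⁆ u
      ... | no w≢u   = contradiction (w , w∈S , w≢u) ¬p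

    nonempty : ∃ λ u → u ∈ S
    nonempty with Subset.nonempty? S
    ... | yes ne = ne
    ... | no ¬ne = contradiction (trans (sym ∣S∣≡κ) (trans (cong ∣_∣ (Subset.Empty-unique ¬ne)) (Subset.∣⊥∣≡0 n)))
                     (m<n⇒n≢0 2≤κ)

    -- If `S` is monochromatic, take the next colour: omitting a vertex of `S` leaves `v` and, as
    -- `κ` is at least 2, another vertex of `S` of a different colour. Otherwise take the colour
    -- before that of some `w₀`: omitting `v` leaves two colours, omitting `w₀` is consistent with
    -- the rule, and omitting any other vertex leaves `v` and `w₀`, whose colours differ.
    extendingColour : ∃ λ c → ∀ v → v ∉ S → colour v ≡ c → Cyclic (⁅ v ⁆ ∪ S)
    extendingColour with w₀ , w₀∈S ← nonempty
      with Fin.all? (λ w → (w ∈? S) →-dec (colour w Fin.≟ colour w₀))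
    ... | yes mono = next (colour w₀) , cyclic
      where
      cyclic : ∀ v → v ∉ S → colour v ≡ next (colour w₀) → Cyclic (⁅ v ⁆ ∪ S)
      cyclic v v∉S eq u u∈ c others with ∈-insert⁻ u∈
      ... | inj₁ refl = trans eq (cong next (others w₀ (∈-insert-there w₀∈S) λ { refl → v∉S w₀∈S }))
      ... | inj₂ u∈S  = contradiction
        (trans (sym eq) (trans (others v ∈-insert-here λ { refl → v∉S u∈S })
          (let w , w∈S , w≢u = another u
           in trans (sym (others w (∈-insert-there w∈S) w≢u)) (mono w w∈S))))
        (next≢ (colour w₀))
    ... | no ¬mono = prev (colour w₀) , cyclic
      where
      cyclic : ∀ v → v ∉ S → colour v ≡ prev (colour w₀) → Cyclic (⁅ v ⁆ ∪ S)
      cyclic v v∉S eq u u∈ c others with ∈-insert⁻ u∈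
      ... | inj₁ refl = contradiction (λ w w∈S → trans (colour≡c w w∈S) (sym (colour≡c w₀ w₀∈S))) ¬mono
        where
        colour≡c : ∀ w → w ∈ S → colour w ≡ c
        colour≡c w w∈S = others w (∈-insert-there w∈S) λ { refl → v∉S w∈S }
      ... | inj₂ u∈S  with w₀ Fin.≟ u
      ...   | yes refl = trans (sym (next-prev (colour u))) (cong next prev≡c)
        where prev≡c = trans (sym eq) (others v ∈-insert-here λ { refl → v∉S u∈S })
      ...   | no w₀≢u  = contradiction
        (trans (next-prev _) (trans (others w₀ (∈-insert-there w₀∈S) w₀≢u) (sym prev≡c)))
        (next≢ (prev (colour w₀)))
        where prev≡c = trans (sym eq) (others v ∈-insert-here λ { refl → v∉S u∈S })

  module _ (c : Fin p) (n : ℕ) where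

    private
      index< : (j : Fin (n / p)) → toℕ c + toℕ j * p < n
      index< j = begin-strict
        toℕ c + toℕ j * p <⟨ +-monoˡ-< (toℕ j * p) (Fin.toℕ<n c) ⟩
        suc (toℕ j) * p   ≤⟨ *-monoˡ-≤ p (Fin.toℕ<n j) ⟩
        (n / p) * p       ≤⟨ m≤n+m _ (n ℕ.% p) ⟩
        n ℕ.% p + (n / p) * p ≡⟨ m≡m%n+[m/n]*n n p ⟨
        n ∎
        where open ≤-Reasoning

      member : Fin (n / p) → Fin n
      member j = Fin.fromℕ< (index< j)

    -- The vertices `c + j * p` with `j < n / p`. One further vertex of colour `c` may exist, but
    -- rounding down gives the same length for every colour.
    colourClass : List (Fin n)
    colourClass = List.tabulate member

    length-colourClass : length colourClass ≡ n / p
    length-colourClass = List.length-tabulate member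

    colourClass-unique : Uniqueₗ colourClass
    colourClass-unique = Uniqueₗ.tabulate⁺ λ {i} {j} eq → Fin.toℕ-injective
      (*-cancelʳ-≡ (toℕ i) (toℕ j) p (+-cancelˡ-≡ (toℕ c) _ _
        (trans (sym (Fin.toℕ-fromℕ< (index< i))) (trans (cong toℕ eq) (Fin.toℕ-fromℕ< (index< j))))))

    colour-colourClass : ∀ {v} → v ∈ₗ colourClass → colour v ≡ c
    colour-colourClass v∈ with j , refl ← Mem.∈-tabulate⁻ v∈ = Fin.toℕ-injective (begin
      toℕ (toℕ (member j) mod p)  ≡⟨ Fin.toℕ-fromℕ< (m%n<n (toℕ (member j)) p) ⟩
      toℕ (member j) ℕ.% p        ≡⟨ cong (ℕ._% p) (Fin.toℕ-fromℕ< (index< j)) ⟩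
      (toℕ c + toℕ j * p) ℕ.% p   ≡⟨ [m+kn]%n≡m%n (toℕ c) (toℕ j) p ⟩
      toℕ c ℕ.% p                 ≡⟨ m<n⇒m%n≡m (Fin.toℕ<n c) ⟩
      toℕ c                       ∎)
      where open ≡-Reasoning

  -- All vertices of the extending colour class outside `S` give edges, and at most `κ` of the class
  -- lie in `S`.
  codeg-cyclicGraph : ∀ {κ n} → 2 ≤ κ → (S : Subset n) → ∣ S ∣ ≡ κ →
                      n / p ≤ κ + codeg (cyclicGraph κ n) S
  codeg-cyclicGraph {κ} {n} 2≤κ S ∣S∣≡κ = begin
    n / p                                        ≡⟨ length-colourClass c n ⟨
    length (colourClass c n)                     ≤⟨ unique-⊆⇒length≤ (colourClass-unique c n) cover ⟩
    length (elements S List.++ new)              ≡⟨ List.length-++ (elements S) ⟩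
    length (elements S) + length new             ≡⟨ cong (_+ length new) (trans (length-elements S) ∣S∣≡κ) ⟩
    κ + length new                               ≤⟨ +-monoʳ-≤ κ (length≤codeg (cyclicGraph κ n) S new-unique new-extends) ⟩
    κ + codeg (cyclicGraph κ n) S                ∎
    where
    open ≤-Reasoning
    c = proj₁ (extendingColour 2≤κ S ∣S∣≡κ)
    ∉S? = λ v → ¬? (v ∈? S)
    new = filter ∉S? (colourClass c n)
    new-unique = Uniqueₗ.filter⁺ ∉S? (colourClass-unique c n)
    cover : ∀ {v} → v ∈ₗ colourClass c n → v ∈ₗ elements S List.++ new
    cover {v} v∈ with v ∈? S
    ... | yes v∈S = Mem.∈-++⁺ˡ (∈⇒∈elements v∈S)
    ... | no  v∉S = Mem.∈-++⁺ʳ (elements S) (Mem.∈-filter⁺ ∉S? v∈ v∉S)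
    new-extends : ∀ {v} → v ∈ₗ new → v ∉ S × T (edge (cyclicGraph κ n) (⁅ v ⁆ ∪ S))
    new-extends {v} v∈ with v∈c , v∉S ← Mem.∈-filter⁻ ∉S? {xs = colourClass c n} v∈ =
      v∉S , fromWitness
        ( trans (∣insert∣ S v∉S) (cong suc ∣S∣≡κ)
        , proj₂ (extendingColour 2≤κ S ∣S∣≡κ) v v∉S (colour-colourClass c n v∈c))

  cyclicRate : ∀ κ Fs a b → 2 ≤ κ → a * p < b → (∀ n → Free (cyclicGraph κ n) Fs) →
               -- With `x = a * p`, rounding and the vertices of `S` cost `x * suc κ`. Beyond this
               -- threshold the codegree `d` is at least that cost, so it is paid by the spare `d`
               -- in `suc x * d ≤ b * d`.
               EventuallyCoexAtLeast (suc κ) Fs a b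
  cyclicRate κ Fs a b 2≤κ ap<b free = (κ + x * suc κ) * p , λ n N≤n →
    cyclicGraph κ n , free n , λ S ∣S∣≡κ → rate n N≤n (codeg (cyclicGraph κ n) S) (codeg-cyclicGraph 2≤κ S ∣S∣≡κ)
    where
    open ≤-Reasoning
    x = a * p
    rate : ∀ n → (κ + x * suc κ) * p ≤ n → ∀ d → n / p ≤ κ + d → a * n ≤ b * d
    rate n N≤n d n/p≤κ+d = begin
      a * n                     ≤⟨ *-monoʳ-≤ a n≤ ⟩
      a * (suc (n / p) * p)     ≡⟨ cong (a *_) (*-comm (suc (n / p)) p) ⟩
      a * (p * suc (n / p))     ≡⟨ *-assoc a p _ ⟨
      x * suc (n / p)           ≤⟨ *-monoʳ-≤ x (s≤s n/p≤κ+d) ⟩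
      x * (suc κ + d)           ≡⟨ *-distribˡ-+ x (suc κ) d ⟩
      x * suc κ + x * d         ≤⟨ +-monoˡ-≤ (x * d) large ⟩
      suc x * d                 ≤⟨ *-monoˡ-≤ d ap<b ⟩
      b * d                     ∎
      where
      n≤ : n ≤ suc (n / p) * p
      n≤ = begin
        n                     ≡⟨ m≡m%n+[m/n]*n n p ⟩
        n ℕ.% p + (n / p) * p ≤⟨ +-monoˡ-≤ ((n / p) * p) (<⇒≤ (m%n<n n p)) ⟩
        suc (n / p) * p       ∎
      large : x * suc κ ≤ d
      large = +-cancelˡ-≤ κ _ _ (begin
        κ + x * suc κ             ≡⟨ m*n/n≡m (κ + x * suc κ) p ⟨
        (κ + x * suc κ) * p / p   ≤⟨ /-monoˡ-≤ p N≤n ⟩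
        n / p                     ≤⟨ n/p≤κ+d ⟩
        κ + d                     ∎)

  module _ {κ t m : ℕ} (D : Digraph m) (pκ<t : p * κ < t) where
    open Attach κ t D

    -- By pigeonhole a root set of more than `p * κ` vertices has a monochromatic `κ`-subset. The
    -- copy of `D` attached there starts from a monochromatic node 0, which the second hypothesis
    -- forbids.
    ¬contains : All.All (λ (a , b) → a ≢ b) D →
      (∀ {n} (node : Fin (suc m) → Vec (Fin n) κ) →
        All.All (λ (a , b) → IsArc (cyclicGraph κ n) (node a) (node b)) D →
        ∀ c → ¬ Monochromatic c (node zero)) →
      ∀ {n} → ¬ Contains (cyclicGraph κ n) graph
    ¬contains loopless ¬mono {n} H⊇F
      with g , arcs ← restrict (cyclicGraph κ n) (All.lookup loopless) H⊇F
      with c , c<p , zs , zs⊏ , eqs ← monochromaticSub p κ (Vec.allFin t) (λ i → toℕ (colour (g (inj₁ i))))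
             (VAll.universal (λ i → Fin.toℕ<n _) _) pκ<t
      = ¬mono (λ a → Vec.map g (node j a)) (All.tabulate (arcs j)) (Fin.fromℕ< c<p) mono
      where
      zs∈ = ⊏⇒∈choose zs⊏
      j   = Any.index zs∈
      mono : Monochromatic (Fin.fromℕ< c<p) (Vec.map g (node j zero))
      mono i = Fin.toℕ-injective (begin
        toℕ (colour (lookup (Vec.map g (Vec.map inj₁ (List.lookup roots j))) i))
          ≡⟨ cong (λ xs → toℕ (colour (lookup (Vec.map g (Vec.map inj₁ xs)) i))) (Any.lookup-index zs∈) ⟨
        toℕ (colour (lookup (Vec.map g (Vec.map inj₁ zs)) i))
          ≡⟨ cong (toℕ ∘ colour) (trans (Vec.lookup-map i g (Vec.map inj₁ zs)) (cong g (Vec.lookup-map i inj₁ zs))) ⟩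
        toℕ (colour (g (inj₁ (lookup zs i))))
          ≡⟨ VAll.lookup⁺ eqs i ⟩
        c
          ≡⟨ Fin.toℕ-fromℕ< c<p ⟨
        toℕ (Fin.fromℕ< c<p) ∎)
        where open ≡-Reasoning

  module _ {κ t : ℕ} (0<κ : 0 < κ) (pκ<t : p * κ < t) where

    -- The last node is coloured twice: three steps ahead of `c` along the path and one step ahead
    -- along the chord. As `κ` is positive, the node has a vertex on which the two clash.
    D₂-free : (∀ c → next (next (next c)) ≢ next c) → ∀ {n} →
              ¬ Contains (cyclicGraph κ n) (Attach.graph κ t D₂)
    D₂-free ≢ = ¬contains D₂ pκ<t ((λ ()) ∷ (λ ()) ∷ (λ ()) ∷ (λ ()) ∷ [])
      λ { node (arc₀₁ ∷ arc₁₂ ∷ arc₂₃ ∷ arc₀₃ ∷ []) c mono →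
          let mono₁  = arc-colour (node (# 0)) (node (# 1)) arc₀₁ mono
              mono₂  = arc-colour (node (# 1)) (node (# 2)) arc₁₂ mono₁
              mono₃  = arc-colour (node (# 2)) (node (# 3)) arc₂₃ mono₂
              mono₃′ = arc-colour (node (# 0)) (node (# 3)) arc₀₃ mono
              i      = Fin.fromℕ< 0<κ
          in ≢ c (trans (sym (mono₃ i)) (mono₃′ i)) }

    D₃-free : (∀ c → next (next (next (next c))) ≢ next c) → ∀ {n} →
              ¬ Contains (cyclicGraph κ n) (Attach.graph κ t D₃)
    D₃-free ≢ = ¬contains D₃ pκ<t ((λ ()) ∷ (λ ()) ∷ (λ ()) ∷ (λ ()) ∷ (λ ()) ∷ [])
      λ { node (arc₀₁ ∷ arc₁₂ ∷ arc₂₃ ∷ arc₃₄ ∷ arc₀₄ ∷ []) c mono →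
          let mono₁  = arc-colour (node (# 0)) (node (# 1)) arc₀₁ mono
              mono₂  = arc-colour (node (# 1)) (node (# 2)) arc₁₂ mono₁
              mono₃  = arc-colour (node (# 2)) (node (# 3)) arc₂₃ mono₂
              mono₄  = arc-colour (node (# 3)) (node (# 4)) arc₃₄ mono₃
              mono₄′ = arc-colour (node (# 0)) (node (# 4)) arc₀₄ mono
              i      = Fin.fromℕ< 0<κ
          in ≢ c (trans (sym (mono₄ i)) (mono₄′ i)) }

-- Counting

module _ {A : Set} where

  count : (A → Bool) → List A → ℕ
  count q xs = length (filter (T? ∘ q) xs)

  private
    ι : Bool → ℕ
    ι false = 0
    ι true  = 1

    bonferroni₂ : ∀ c d → ι c + ι d ≤ 1 + ι (c ∧ d)
    bonferroni₂ true  d     = ≤-refl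
    bonferroni₂ false true  = ≤-refl
    bonferroni₂ false false = z≤n

    bonferroni₃ : ∀ b c d → ι b + (ι c + ι d) ≤ 1 + ((ι (b ∧ c) + ι (b ∧ d)) + ι (c ∧ d))
    bonferroni₃ true  c d = s≤s (m≤m+n _ _)
    bonferroni₃ false c d = bonferroni₂ c d

    bonferroni₄ : ∀ a b c d → ι a + (ι b + (ι c + ι d)) ≤
      1 + ((ι (a ∧ b) + (ι (a ∧ c) + ι (a ∧ d))) + ((ι (b ∧ c) + ι (b ∧ d)) + ι (c ∧ d)))
    bonferroni₄ true  b c d = s≤s (m≤m+n _ _)
    bonferroni₄ false b c d = bonferroni₃ b c d

    -- Wrapping the equation keeps both summands recoverable by unification, so that `_⊞_` can be
    -- chained without naming them.
    record IsSum (x a b : ℕ) : Set where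
      constructor isSum
      field eq : x ≡ a + b
    open IsSum

    count-∷ : ∀ q x xs → IsSum (count q (x ∷ xs)) (ι (q x)) (count q xs)
    count-∷ q x xs with q x
    ... | true  = isSum refl
    ... | false = isSum refl

    _⊞_ : ∀ {x y a a′ b b′} → IsSum x a a′ → IsSum y b b′ → IsSum (x + y) (a + b) (a′ + b′)
    _⊞_ {a = a} {a′} {b} {b′} (isSum refl) (isSum refl) = isSum (interchange +-commutativeSemigroup a a′ b b′)

  infixr 7 _⊓_
  _⊓_ : (A → Bool) → (A → Bool) → A → Bool
  (q ⊓ r) x = q x ∧ r x

  -- Bonferroni's inequality, summed pointwise over the list, with the union bounded by the whole
  -- list.
  count-bonferroni : ∀ q r s t xs →
    count q xs + (count r xs + (count s xs + count t xs)) ≤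
    length xs + ((count (q ⊓ r) xs + (count (q ⊓ s) xs + count (q ⊓ t) xs)) +
                 ((count (r ⊓ s) xs + count (r ⊓ t) xs) + count (s ⊓ t) xs))
  count-bonferroni q r s t []       = z≤n
  count-bonferroni q r s t (x ∷ xs) = subst₂ _≤_
    (sym (eq (c q ⊞ (c r ⊞ (c s ⊞ c t)))))
    (sym (eq (isSum {a = 1} {length xs} refl ⊞
      ((c (q ⊓ r) ⊞ (c (q ⊓ s) ⊞ c (q ⊓ t))) ⊞ ((c (r ⊓ s) ⊞ c (r ⊓ t)) ⊞ c (s ⊓ t))))))
    (+-mono-≤ (bonferroni₄ (q x) (r x) (s x) (t x)) (count-bonferroni q r s t xs))
    where c = λ q → count-∷ q x xs

-- Greedy choice of disjoint copies

greedyChoice : ∀ {X I : Set} (is : List I) → (∀ i → i ∈ₗ is) →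
  ∀ s (P : Fin s → (I → X) → Set) w W → length W + s * length is ≤ w →
  (∀ j W → length W ≤ w →
     ¬ ¬ ∃ λ G → (∀ {x y} → G x ≡ G y → x ≡ y) × (∀ x → G x ∉ₗ W) × P j G) →
  ¬ ¬ ∃ λ (G : Fin s → I → X) → (∀ {i j x y} → G i x ≡ G j y → (i , x) ≡ (j , y)) ×
                                 (∀ j x → G j x ∉ₗ W) × (∀ j → P j (G j))
greedyChoice is ∈is zero    P w W le choice =
  pure ((λ ()) , (λ { {()} }) , (λ ()) , (λ ()))
greedyChoice is ∈is (suc s) P w W le choice =
  choice zero W (≤-trans (m≤m+n _ _) le) >>= λ (G₀ , G₀-inj , G₀∉W , PG₀) →
  greedyChoice is ∈is s (P ∘ suc) w (List.map G₀ is List.++ W)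
    (≤-trans (≤-reflexive (length-eq G₀)) le) (choice ∘ suc) >>= λ (G , G-inj , G∉ , PG) →
  pure ( (λ { zero → G₀ ; (suc j) → G j })
       , (λ { {zero}  {zero}  eq → cong (zero ,_) (G₀-inj eq)
            ; {zero}  {suc j} {x} {y} eq → contradiction
                (Mem.∈-++⁺ˡ (subst (_∈ₗ List.map G₀ is) eq (Mem.∈-map⁺ G₀ (∈is x)))) (G∉ j y)
            ; {suc i} {zero}  {x} {y} eq → contradiction
                (Mem.∈-++⁺ˡ (subst (_∈ₗ List.map G₀ is) (sym eq) (Mem.∈-map⁺ G₀ (∈is y)))) (G∉ i x)
            ; {suc i} {suc j} eq → cong (map₁ suc) (G-inj eq) })
       , (λ { zero → G₀∉W ; (suc j) x → G∉ j x ∘ Mem.∈-++⁺ʳ (List.map G₀ is) })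
       , (λ { zero → PG₀ ; (suc j) → PG j }) )
  where
  length-eq : ∀ G₀ → length (List.map G₀ is List.++ W) + s * length is ≡ length W + suc s * length is
  length-eq G₀ = trans
    (cong (_+ s * length is) (trans (List.length-++ (List.map G₀ is)) (cong (_+ length W) (List.length-map G₀ is))))
    (xy∙z≈y∙xz +-commutativeSemigroup (length is) (length W) (s * length is))

module _ {κ n : ℕ} (H : KGraph (suc κ) n) where

  place : ∀ {m} → Vec (Fin n) κ → (Fin m × Fin κ → Fin n) → Fin (suc m) → Vec (Fin n) κ
  place u G zero    = u
  place u G (suc i) = Vec.tabulate λ a → G (i , a)

  Gadget : ∀ {m} → Digraph m → List (Fin n) → Vec (Fin n) κ → Set
  Gadget {m} D W u =
    ∃ λ (G : Fin m × Fin κ → Fin n) → (∀ {x y} → G x ≡ G y → x ≡ y) × (∀ x → G x ∉ₗ W) ×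
      (∀ {a b} → (a , b) ∈ₗ D → IsArc H (place u G a) (place u G b))

  Extendable : ∀ {m} → Digraph m → ℕ → Vec (Fin n) κ → Set
  Extendable D w u = ∀ W → length W ≤ w → ¬ ¬ Gadget D W u

slots : ∀ m κ → List (Fin m × Fin κ)
slots m κ = List.cartesianProduct (allFin m) (allFin κ)

module _ (κ t : ℕ) {m : ℕ} (D : Digraph m) where
  open Attach κ t D

  -- The number of vertices in the root set and all copies attached to it, hence the most that a
  -- greedy embedding ever has to avoid.
  avoidance : ℕ
  avoidance = t + length roots * length (slots m κ)

  extendable⇒contains : ∀ {n} (H : KGraph (suc κ) n) {ys : Vec (Fin n) t} → Unique ys →
    (∀ zs → zs ⊏ ys → Extendable H D avoidance zs) → ¬ ¬ Contains H graph
  extendable⇒contains {n} H {ys} ys-unique ext =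
    greedyChoice (slots m κ) (λ (i , a) → Mem.∈-cartesianProduct⁺ (Mem.∈-allFin i) (Mem.∈-allFin a))
      (length roots) (λ j G → ∀ {a b} → (a , b) ∈ₗ D → IsArc H (place H (base j) G a) (place H (base j) G b))
      avoidance (toList ys) (≤-reflexive (cong (_+ length roots * length (slots m κ)) (Vec.length-toList ys)))
      (λ j → ext (base j) (base⊏ j))
    >>= λ (G , G-inj , G∉ , arcs) →
      let g : Vertex → Fin n
          g = Sum.[ lookup ys , uncurry G ]

          ∈ys : ∀ i → lookup ys i ∈ₗ toList ys
          ∈ys i = VMem.∈-toList⁺ (VMem.∈-lookup i ys)

          g-inj : ∀ {x y} → g x ≡ g y → x ≡ y
          g-inj = λ
            { {inj₁ i} {inj₁ j} eq → cong inj₁ (Unique.lookup-injective ys-unique i j eq)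
            ; {inj₁ i} {inj₂ y} eq → contradiction (subst (_∈ₗ _) eq (∈ys i)) (uncurry G∉ y)
            ; {inj₂ x} {inj₁ j} eq → contradiction (subst (_∈ₗ _) (sym eq) (∈ys j)) (uncurry G∉ x)
            ; {inj₂ x} {inj₂ y} eq → cong inj₂ (G-inj eq)
            }

          node≡ : ∀ j a → Vec.map g (node j a) ≡ place H (base j) (G j) a
          node≡ j = λ where
            zero    → sym (Vec.map-∘ g inj₁ (List.lookup roots j))
            (suc i) → sym (Vec.tabulate-∘ g _)
      in pure (embed H g g-inj λ j {a} {b} ab∈D →
           subst₂ (IsArc H) (sym (node≡ j a)) (sym (node≡ j b)) (arcs j ab∈D))
    where
    base : Fin (length roots) → Vec (Fin n) κ
    base j = Vec.map (lookup ys) (List.lookup roots j)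
    base⊏ : ∀ j → base j ⊏ ys
    base⊏ j = subst (base j ⊏_) (Vec.map-lookup-allFin ys)
      (⊏-map (lookup ys) (∈choose⇒⊏ (Vec.allFin t) (Mem.∈-lookup j)))

-- The upper bound

module _ (κ t : ℕ) where

  -- A sum so as to dominate the avoidance bounds of both digraphs.
  obstacleBound : ℕ
  obstacleBound = avoidance κ t D₂ + avoidance κ t D₃

  -- Each new blocked tuple is chosen avoiding at most four earlier ones, hence the factor 4.
  poolSize : ℕ
  poolSize = 4 * (obstacleBound + obstacleBound + κ) + ramseyNumber κ t t

module UpperBound {κ n : ℕ} (H : KGraph (suc κ) n) (t : ℕ)
  (¬G₂ : ¬ Contains H (Attach.graph κ t D₂)) (¬G₃ : ¬ Contains H (Attach.graph κ t D₃)) where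

  private
    w = obstacleBound κ t
    M = poolSize κ t

  -- A tuple u to which no copy of D₂ or D₃ disjoint from the obstacles can be attached at node 0.
  record Blocked : Set where
    field
      tuple      : Vec (Fin n) κ
      unique     : Unique tuple
      obstacles  : List (Fin n)
      obstacles≤ : length obstacles ≤ w + w
      ¬gadget₂   : ¬ Gadget H D₂ obstacles tuple
      ¬gadget₃   : ¬ Gadget H D₃ obstacles tuple
  open Blocked

  nb : Blocked → Fin n → Bool
  nb u v = edge H ⟪ v ∷ tuple u ⟫

  deg : (Fin n → Bool) → ℕ
  deg q = count q (allFin n)

  forbidden : Blocked → List (Fin n)
  forbidden u = obstacles u List.++ toList (tuple u)

  infix 4 _≺_ _⟶_
  -- Means that `v` was chosen after `u`: its vertices avoid those of `u` and also the obstacles of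
  -- `u`, so they may serve in a gadget issuing from `u`.
  record _≺_ (u v : Blocked) : Set where
    constructor ≺-intro
    field fresh : ∀ i → lookup (tuple v) i ∉ₗ forbidden u
  open _≺_

  record _⟶_ (u v : Blocked) : Set where
    constructor _,⟶_
    field
      before : u ≺ v
      arc    : IsArc H (tuple u) (tuple v)
  open _⟶_

  gadget-mono : ∀ {m} {D : Digraph m} {W W′ u} → (∀ {x} → x ∈ₗ W → x ∈ₗ W′) →
                Gadget H D W′ u → Gadget H D W u
  gadget-mono sub (G , inj , G∉ , arcs) = G , inj , (λ x → G∉ x ∘ sub) , arcs

  -- The order `≺` makes the tuples disjoint from each other and from the obstacles of `u`, so a
  -- copy of `D` among them contradicts that `u` is blocked.
  gadget : ∀ {m} {D : Digraph m} u (vs : Vec Blocked m) → AllPairsᵥ _≺_ (u ∷ vs) →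
           All.All (λ (a , b) → IsArc H (tuple (lookup (u ∷ vs) a)) (tuple (lookup (u ∷ vs) b))) D →
           Gadget H D (obstacles u) (tuple u)
  gadget {m} u vs (u≺vs ∷ vs-≺) arcs = G , G-inj , G∉ , λ {a} {b} ab∈D →
    subst₂ (IsArc H) (sym (place≡ a)) (sym (place≡ b)) (All.lookup arcs ab∈D)
    where
    G : Fin m × Fin κ → Fin n
    G (i , a) = lookup (tuple (lookup vs i)) a
    disjoint : ∀ {i j a b} → i Fin.< j → G (i , a) ≢ G (j , b)
    disjoint {i} {j} {a} {b} i<j eq = fresh (lookup-AllPairs vs-≺ i<j) b
      (Mem.∈-++⁺ʳ (obstacles (lookup vs i)) (subst (_∈ₗ _) eq (VMem.∈-toList⁺ (VMem.∈-lookup a _))))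
    G-inj : ∀ {x y} → G x ≡ G y → x ≡ y
    G-inj {i , a} {j , b} eq with Fin.<-cmp i j
    ... | tri< i<j _ _  = contradiction eq (disjoint i<j)
    ... | tri≈ _ refl _ = cong (i ,_) (Unique.lookup-injective (unique (lookup vs i)) a b eq)
    ... | tri> _ _ j<i  = contradiction (sym eq) (disjoint j<i)
    G∉ : ∀ x → G x ∉ₗ obstacles u
    G∉ (i , a) x∈ = fresh (VAll.lookup⁺ u≺vs i) a (Mem.∈-++⁺ˡ x∈)
    place≡ : ∀ a → place H (tuple u) G a ≡ tuple (lookup (u ∷ vs) a)
    place≡ zero    = refl
    place≡ (suc i) = Vec.tabulate∘lookup (tuple (lookup vs i))

  forbidden≤ : ∀ u → length (forbidden u) ≤ w + w + κ
  forbidden≤ u = ≤-trans (≤-reflexive (List.length-++ (obstacles u)))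
    (+-mono-≤ (obstacles≤ u) (≤-reflexive (Vec.length-toList (tuple u))))

  _≺*_ : List Blocked → Blocked → Set
  []      ≺* v = ⊤
  (u ∷ Γ) ≺* v = u ≺ v × Γ ≺* v

  All⇒≺* : ∀ {v Γ} → All.All (_≺ v) Γ → Γ ≺* v
  All⇒≺* []         = _
  All⇒≺* (u≺v ∷ ps) = u≺v , All⇒≺* ps

  -- After removal of what `Γ` forbids, the pool still has Ramsey size. If no tuple of it were
  -- blocked, each would be extendable for `D₂` or `D₃`, and a homogeneous set of `t` vertices would
  -- be the root set of a copy of `G₂` or `G₃`.
  pick : ∀ q → M ≤ deg q → (Γ : List Blocked) {_ : T (length Γ ℕ.≤ᵇ 4)} →
         ¬ ¬ ∃ λ v → Γ ≺* v × (∀ i → T (q (lookup (tuple v) i)))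
  pick q M≤ Γ {Γ≤4} none =
    ramsey κ t t R≤ (Vec.fromList pool) (Extendable H D₂ w) (Extendable H D₃ w) extendable
      Sum.[ (λ (ys , ys⊏ , ext) → extendable⇒contains κ t D₂ H (⊏-Unique ys⊏ pool-unique)
              (λ zs zs⊏ W W≤ → ext zs zs⊏ W (≤-trans W≤ (m≤m+n _ _))) ¬G₂)
          , (λ (ys , ys⊏ , ext) → extendable⇒contains κ t D₃ H (⊏-Unique ys⊏ pool-unique)
              (λ zs zs⊏ W W≤ → ext zs zs⊏ W (≤-trans W≤ (m≤n+m (avoidance κ t D₃) (avoidance κ t D₂)))) ¬G₃) ]
    where
    banned = List.concatMap forbidden Γ
    _∈ᵇ?_ = DecMem._∈?_ (Fin._≟_ {n})
    allowed? : ∀ v → Dec (T (q v) × v ∉ₗ banned)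
    allowed? v = T? (q v) ×-dec ¬? (v ∈ᵇ? banned)
    pool = filter allowed? (allFin n)
    pool-unique : Unique (Vec.fromList pool)
    pool-unique = fromList-unique (Uniqueₗ.filter⁺ allowed? (Uniqueₗ.allFin⁺ n))

    cover : ∀ {v} → v ∈ₗ filter (T? ∘ q) (allFin n) → v ∈ₗ banned List.++ pool
    cover {v} v∈ with v ∈ᵇ? banned
    ... | yes v∈b = Mem.∈-++⁺ˡ v∈b
    ... | no  v∉b = Mem.∈-++⁺ʳ banned (Mem.∈-filter⁺ allowed? (Mem.∈-allFin v)
                      (proj₂ (Mem.∈-filter⁻ (T? ∘ q) {xs = allFin n} v∈) , v∉b))

    R≤ : ramseyNumber κ t t ≤ length pool
    R≤ = +-cancelˡ-≤ (4 * (w + w + κ)) _ _ (begin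
      M                                    ≤⟨ M≤ ⟩
      deg q                                ≤⟨ unique-⊆⇒length≤ (Uniqueₗ.filter⁺ _ (Uniqueₗ.allFin⁺ n)) cover ⟩
      length (banned List.++ pool)         ≡⟨ List.length-++ banned ⟩
      length banned + length pool          ≤⟨ +-monoˡ-≤ _ (length-concatMap≤ forbidden _ forbidden≤ Γ) ⟩
      length Γ * (w + w + κ) + length pool ≤⟨ +-monoˡ-≤ _ (*-monoˡ-≤ (w + w + κ) (≤ᵇ⇒≤ (length Γ) 4 Γ≤4)) ⟩
      4 * (w + w + κ) + length pool        ∎)
      where open ≤-Reasoning

    extendable : ∀ zs → zs ⊏ Vec.fromList pool → ¬ ¬ (Extendable H D₂ w zs ⊎ Extendable H D₃ w zs)
    -- `W₂` witnesses that `D₂` cannot be attached and `W₃` does so for `D₃`. Their concatenation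
    -- defeats both, whence the bound `w + w` on obstacles.
    extendable zs zs⊏ neither = neither (inj₁ λ W₂ W₂≤ ¬g₂ → neither (inj₂ λ W₃ W₃≤ ¬g₃ → none
      ( record
          { tuple      = zs
          ; unique     = ⊏-Unique zs⊏ pool-unique
          ; obstacles  = W₂ List.++ W₃
          ; obstacles≤ = ≤-trans (≤-reflexive (List.length-++ W₂)) (+-mono-≤ W₂≤ W₃≤)
          ; ¬gadget₂   = ¬g₂ ∘ gadget-mono {D = D₂} Mem.∈-++⁺ˡ
          ; ¬gadget₃   = ¬g₃ ∘ gadget-mono {D = D₃} (Mem.∈-++⁺ʳ W₂)
          }
      , All⇒≺* (All.tabulate λ {u} u∈Γ → ≺-intro λ i x∈ →
          proj₂ (zs-allowed i) (Mem.∈-concatMap⁺ forbidden (Any.map (λ { refl → x∈ }) u∈Γ)))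
      , proj₁ ∘ zs-allowed)))
      where
      zs-allowed : ∀ i → T (q (lookup zs i)) × lookup zs i ∉ₗ banned
      zs-allowed = VAll.lookup⁺ (⊏-All zs⊏ (VAll.fromList⁺ (All.tabulate λ v∈ →
        proj₂ (Mem.∈-filter⁻ allowed? {xs = allFin n} v∈))))

  -- Almost disjoint neighbourhoods. When this fails, the intersection is large enough for `pick` to
  -- find a common out-neighbour.
  _≁_ : Blocked → Blocked → Set
  u ≁ v = deg (nb u ⊓ nb v) < M

  pick₂ : ∀ u v → ¬ (u ≁ v) → (Γ : List Blocked) {_ : T (length Γ ℕ.≤ᵇ 4)} →
          ¬ ¬ ∃ λ s → Γ ≺* s × IsArc H (tuple u) (tuple s) × IsArc H (tuple v) (tuple s)
  pick₂ u v u~v Γ {Γ≤4} = (λ (s , Γ≺s , qs) →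
      s , Γ≺s , proj₁ ∘ Equivalence.to Bool.T-∧ ∘ qs , proj₂ ∘ Equivalence.to Bool.T-∧ ∘ qs)
    <$> pick (nb u ⊓ nb v) (≮⇒≥ u~v) Γ {Γ≤4}

  -- Lets the doubly negated choices of `pick` prove positive facts.
  ≁-stable : ∀ u v → ¬ ¬ (u ≁ v) → u ≁ v
  ≁-stable u v = decidable-stable (deg (nb u ⊓ nb v) <? M)

  -- A common out-neighbour `s` of `u` and `v` would complete the path `u`, `a`, `v`, `s` with chord
  -- from `u` to `s`, a copy of `D₂` at a blocked tuple. In `path₃` the path is one longer and `D₃`
  -- arises.
  path₂ : ∀ {u a v} → u ⟶ a → u ≺ v → a ⟶ v → u ≁ v
  path₂ {u} {a} {v} u⟶a u≺v a⟶v = ≁-stable u v λ u~v →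
    pick₂ u v u~v (u ∷ a ∷ v ∷ []) λ (s , (u≺s , a≺s , v≺s , _) , us , vs) →
    ¬gadget₂ u (gadget u (a ∷ v ∷ s ∷ [])
      ((before u⟶a ∷ u≺v ∷ u≺s ∷ []) ∷ (before a⟶v ∷ a≺s ∷ []) ∷ (v≺s ∷ []) ∷ [] ∷ [])
      (arc u⟶a ∷ arc a⟶v ∷ vs ∷ us ∷ []))

  path₃ : ∀ {u a b v} → u ⟶ a → u ≺ b → u ≺ v → a ⟶ b → a ≺ v → b ⟶ v → u ≁ v
  path₃ {u} {a} {b} {v} u⟶a u≺b u≺v a⟶b a≺v b⟶v = ≁-stable u v λ u~v →
    pick₂ u v u~v (u ∷ a ∷ b ∷ v ∷ []) λ (s , (u≺s , a≺s , b≺s , v≺s , _) , us , vs) →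
    ¬gadget₃ u (gadget u (a ∷ b ∷ v ∷ s ∷ [])
      ((before u⟶a ∷ u≺b ∷ u≺v ∷ u≺s ∷ []) ∷ (before a⟶b ∷ a≺v ∷ a≺s ∷ []) ∷
       (before b⟶v ∷ b≺s ∷ []) ∷ (v≺s ∷ []) ∷ [] ∷ [])
      (arc u⟶a ∷ arc a⟶b ∷ arc b⟶v ∷ vs ∷ us ∷ []))

  CodegreesLarge : Set
  CodegreesLarge = ∀ (zs : Vec (Fin n) κ) → Unique zs → 3 * n < 10 * deg (λ v → edge H ⟪ v ∷ zs ⟫)

  module _ (n-large : 30 * M ≤ n) (codegreesLarge : CodegreesLarge) where

    deg-large : ∀ u → 3 * n < 10 * deg (nb u)
    deg-large u = codegreesLarge (tuple u) (unique u)

    M≤deg : ∀ u → M ≤ deg (nb u)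
    M≤deg u = *-cancelˡ-≤ 10 (≤-trans (*-monoˡ-≤ M (≤ᵇ⇒≤ 10 30 _))
      (≤-trans n-large (≤-trans (m≤m+n n (2 * n)) (<⇒≤ (deg-large u)))))

    -- The four degrees sum to more than `12 n / 10`, so the six intersections sum to more than
    -- `n / 5`. But each is smaller than `M`, which is at most `n / 30`.
    fourNeighbourhoods : ∀ a b c d → a ≁ b → a ≁ c → a ≁ d → b ≁ c → b ≁ d → c ≁ d → ⊥
    fourNeighbourhoods a b c d ab ac ad bc bd cd = <⇒≱ (begin-strict
      4 * (3 * n)
        <⟨ +-mono-< (deg-large a) (+-mono-< (deg-large b) (+-mono-< (deg-large c)
             (+-monoˡ-< 0 (deg-large d)))) ⟩
      10 * deg (nb a) + (10 * deg (nb b) + (10 * deg (nb c) + (10 * deg (nb d) + 0)))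
        ≡⟨ distrib (deg (nb a)) (deg (nb b)) (deg (nb c)) (deg (nb d)) ⟩
      10 * (deg (nb a) + (deg (nb b) + (deg (nb c) + deg (nb d))))
        ≤⟨ *-monoʳ-≤ 10 (count-bonferroni (nb a) (nb b) (nb c) (nb d) (allFin n)) ⟩
      10 * (length (allFin n) + ((deg (nb a ⊓ nb b) + (deg (nb a ⊓ nb c) + deg (nb a ⊓ nb d))) +
            ((deg (nb b ⊓ nb c) + deg (nb b ⊓ nb d)) + deg (nb c ⊓ nb d))))
        ≤⟨ *-monoʳ-≤ 10 (+-mono-≤ (≤-reflexive (List.length-tabulate {n = n} id))
             (+-mono-≤ (+-mono-≤ (<⇒≤ ab) (+-mono-≤ (<⇒≤ ac) (<⇒≤ ad)))
                       (+-mono-≤ (+-mono-≤ (<⇒≤ bc) (<⇒≤ bd)) (<⇒≤ cd)))) ⟩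
      10 * (n + ((M + (M + M)) + ((M + M) + M)))
        ≡⟨ collect n M ⟩
      10 * n + 2 * (30 * M) ∎)
      (begin
      10 * n + 2 * (30 * M) ≤⟨ +-monoʳ-≤ (10 * n) (*-monoʳ-≤ 2 n-large) ⟩
      10 * n + 2 * n        ≡⟨ twelve n ⟩
      4 * (3 * n) ∎)
      where
      open ≤-Reasoning
      distrib : ∀ a b c d → 10 * a + (10 * b + (10 * c + (10 * d + 0))) ≡ 10 * (a + (b + (c + d)))
      distrib = solve-∀
      collect : ∀ n m → 10 * (n + ((m + (m + m)) + ((m + m) + m))) ≡ 10 * n + 2 * (30 * m)
      collect = solve-∀
      twelve : ∀ n → 10 * n + 2 * n ≡ 4 * (3 * n)
      twelve = solve-∀

    -- The path lemmas cover distances 2 and 3; a single arc needs a repair. If `x ⟶ y` and the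
    -- neighbourhoods overlap, a common out-neighbour `z` is reached from `x` both directly and
    -- through `y`, so it can replace `y` and `path₂` gives `x ≁ z`. Here `c` replaces `b`, and the
    -- path is continued from `c`, with the same repair wherever a later arc overlaps.
    arc⇒≁ : ∀ {a b} → a ⟶ b → a ≁ b
    arc⇒≁ {a} {b} (a≺b ,⟶ ab) = ≁-stable a b λ a~b →
      pick₂ a b a~b (a ∷ b ∷ []) λ (c , (a≺c , b≺c , _) , ac , bc) →
      pick (nb c) (M≤deg c) (a ∷ b ∷ c ∷ []) λ (c₁ , (a≺c₁ , b≺c₁ , c≺c₁ , _) , cc₁) →
      pick (nb c₁) (M≤deg c₁) (a ∷ c ∷ c₁ ∷ []) λ (c₂ , (a≺c₂ , c≺c₂ , c₁≺c₂ , _) , c₁c₂) →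
      let a⟶c   = a≺c ,⟶ ac
          c⟶c₁  = c≺c₁ ,⟶ cc₁
          c₁⟶c₂ = c₁≺c₂ ,⟶ c₁c₂
          a≁c   = path₂ (a≺b ,⟶ ab) a≺c (b≺c ,⟶ bc)
          a≁c₁  = path₂ a⟶c a≺c₁ c⟶c₁
          -- Otherwise `d` replaces `c₁`, and the fourth tuple after `a`, `c`, `d` is `d₁`, or `e`
          -- in its place if `d` and `d₁` overlap.
          c≁c₁ : c ≁ c₁
          c≁c₁ = ≁-stable c c₁ λ c~c₁ →
            pick₂ c c₁ c~c₁ (a ∷ c ∷ c₁ ∷ []) λ (d , (a≺d , c≺d , c₁≺d , _) , cd , c₁d) →
            pick (nb d) (M≤deg d) (a ∷ c ∷ d ∷ []) λ (d₁ , (a≺d₁ , c≺d₁ , d≺d₁ , _) , dd₁) →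
            let c⟶d  = c≺d ,⟶ cd
                d⟶d₁ = d≺d₁ ,⟶ dd₁
                a≁d  = path₂ a⟶c a≺d c⟶d
                c≁d  = path₂ c⟶c₁ c≺d (c₁≺d ,⟶ c₁d)
                d≁d₁ : d ≁ d₁
                d≁d₁ = ≁-stable d d₁ λ d~d₁ →
                  pick₂ d d₁ d~d₁ (a ∷ c ∷ d ∷ d₁ ∷ []) λ (e , (a≺e , c≺e , d≺e , d₁≺e , _) , de , d₁e) →
                  let d⟶e = d≺e ,⟶ de
                  in fourNeighbourhoods a c d e a≁c a≁d (path₃ a⟶c a≺d a≺e c⟶d c≺e d⟶e)
                       c≁d (path₂ c⟶d c≺e d⟶e) (path₂ d⟶d₁ d≺e (d₁≺e ,⟶ d₁e))
            in fourNeighbourhoods a c d d₁ a≁c a≁d (path₃ a⟶c a≺d a≺d₁ c⟶d c≺d₁ d⟶d₁)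
                 c≁d (path₂ c⟶d c≺d₁ d⟶d₁) d≁d₁
          -- Otherwise `d` replaces `c₂` as the fourth tuple after `a`, `c`, `c₁`.
          c₁≁c₂ : c₁ ≁ c₂
          c₁≁c₂ = ≁-stable c₁ c₂ λ c₁~c₂ →
            pick₂ c₁ c₂ c₁~c₂ (a ∷ c ∷ c₁ ∷ c₂ ∷ []) λ (d , (a≺d , c≺d , c₁≺d , c₂≺d , _) , c₁d , c₂d) →
            let c₁⟶d = c₁≺d ,⟶ c₁d
            in fourNeighbourhoods a c c₁ d a≁c a≁c₁ (path₃ a⟶c a≺c₁ a≺d c⟶c₁ c≺d c₁⟶d)
                 c≁c₁ (path₂ c⟶c₁ c≺d c₁⟶d) (path₂ c₁⟶c₂ c₁≺d (c₂≺d ,⟶ c₂d))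
      in fourNeighbourhoods a c c₁ c₂ a≁c a≁c₁ (path₃ a⟶c a≺c₁ a≺c₂ c⟶c₁ c≺c₂ c₁⟶c₂)
           c≁c₁ (path₂ c⟶c₁ c≺c₂ c₁⟶c₂) c₁≁c₂

    -- On a path of four blocked tuples every pair is at distance 1, 2 or 3, and each distance is
    -- covered.
    ¬codegreesLarge : ⊥
    ¬codegreesLarge =
      pick (λ _ → true) (≤-trans (m≤m+n M (29 * M)) (≤-trans n-large (≤-reflexive (sym deg-true))))
        [] λ (a , _ , _) →
      pick (nb a) (M≤deg a) (a ∷ []) λ (b , (a≺b , _) , ab) →
      pick (nb b) (M≤deg b) (a ∷ b ∷ []) λ (c , (a≺c , b≺c , _) , bc) →
      pick (nb c) (M≤deg c) (a ∷ b ∷ c ∷ []) λ (d , (a≺d , b≺d , c≺d , _) , cd) →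
      let a⟶b = a≺b ,⟶ ab
          b⟶c = b≺c ,⟶ bc
          c⟶d = c≺d ,⟶ cd
      in fourNeighbourhoods a b c d (arc⇒≁ a⟶b) (path₂ a⟶b a≺c b⟶c) (path₃ a⟶b a≺c a≺d b⟶c b≺d c⟶d)
           (arc⇒≁ b⟶c) (path₂ b⟶c b≺d c⟶d) (arc⇒≁ c⟶d)
      where
      deg-true : deg (λ _ → true) ≡ n
      deg-true = trans (cong length (List.filter-all (λ _ → T? true) (All.universal (λ _ → _) (allFin n))))
                   (List.length-tabulate id)

-- The two graphs and their rates

rootSize : ℕ → ℕ
-- Four is the largest number of colours used below.
rootSize κ = suc (4 * κ)

G₂ G₃ : ∀ κ → AnyKGraph (suc κ)
G₂ κ = Attach.size κ (rootSize κ) D₂ , Attach.graph κ (rootSize κ) D₂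
G₃ κ = Attach.size κ (rootSize κ) D₃ , Attach.graph κ (rootSize κ) D₃

G₂G₃-coex≤3/10 : ∀ κ → EventuallyCoexAtMost (suc κ) (G₂ κ ∷ G₃ κ ∷ []) 3 10
G₂G₃-coex≤3/10 κ = 30 * poolSize κ t , λ n N≤n H free →
  case Subset.anySubset? (λ S → (∣ S ∣ ℕ.≟ κ) ×-dec (10 * codeg H S ≤? 3 * n)) of λ where
    (yes small) → small
    (no ¬small) →
      ⊥-elim (UpperBound.¬codegreesLarge H t (free (G₂ κ) (here refl)) (free (G₃ κ) (there (here refl))) N≤n
        λ zs zs-unique →
          let ∣S∣≡κ = ∣⟪⟫∣ zs-unique
          in ≤-trans (≰⇒> λ le → ¬small (⟪ zs ⟫ , ∣S∣≡κ , le))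
               (*-monoʳ-≤ 10 (codeg≤∣extending∣ H ⟪ zs ⟫ ∣S∣≡κ)))
  where t = rootSize κ

-- Adding `p` is subtracting one modulo `suc p`.
rotate unrotate : ∀ p → Fin (suc p) → Fin (suc p)
rotate   p c = suc (toℕ c) mod suc p
unrotate p c = (toℕ c + p) mod suc p

agree? : ∀ {p} (f g : Fin p → Fin p) → Dec (∀ c → f c ≡ g c)
agree? f g = Fin.all? λ c → f c Fin.≟ g c

differ? : ∀ {p} (f g : Fin p → Fin p) → Dec (∀ c → f c ≢ g c)
differ? f g = Fin.all? λ c → ¬? (f c Fin.≟ g c)

module C₂ = Cyclic 2 (rotate 1) (unrotate 1)
  (from-yes (agree? (rotate 1 ∘ unrotate 1) id)) (from-yes (differ? (rotate 1) id))
module C₃ = Cyclic 3 (rotate 2) (unrotate 2)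
  (from-yes (agree? (rotate 2 ∘ unrotate 2) id)) (from-yes (differ? (rotate 2) id))
module C₄ = Cyclic 4 (rotate 3) (unrotate 3)
  (from-yes (agree? (rotate 3 ∘ unrotate 3) id)) (from-yes (differ? (rotate 3) id))

module _ {κ : ℕ} (2≤κ : 2 ≤ κ) where

  private
    0<κ : 0 < κ
    0<κ = ≤-trans (s≤s z≤n) 2≤κ

    colours<rootSize : ∀ p → p ≤ 4 → p * κ < rootSize κ
    colours<rootSize p p≤4 = s≤s (*-monoˡ-≤ κ p≤4)

  -- Four divides neither 2 nor 3, so four colours exclude both graphs, and `1/5` lies below `1/4`.
  G₂G₃-coex≥1/5 : EventuallyCoexAtLeast (suc κ) (G₂ κ ∷ G₃ κ ∷ []) 1 5
  G₂G₃-coex≥1/5 = C₄.cyclicRate κ (G₂ κ ∷ G₃ κ ∷ []) 1 5 2≤κ ≤-refl free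
    where
    free : ∀ n → Free (C₄.cyclicGraph κ n) (G₂ κ ∷ G₃ κ ∷ [])
    free n F (here refl)         = C₄.D₂-free 0<κ (colours<rootSize 4 ≤-refl)
      (from-yes (differ? (rotate 3 ∘ rotate 3 ∘ rotate 3) (rotate 3)))
    free n F (there (here refl)) = C₄.D₃-free 0<κ (colours<rootSize 4 ≤-refl)
      (from-yes (differ? (rotate 3 ∘ rotate 3 ∘ rotate 3 ∘ rotate 3) (rotate 3)))

  -- Three does not divide 2; the rate is chosen between `3/10` and `1/3`.
  G₂-coex≥5/16 : EventuallyCoexAtLeast (suc κ) (G₂ κ ∷ []) 5 16
  G₂-coex≥5/16 = C₃.cyclicRate κ (G₂ κ ∷ []) 5 16 2≤κ ≤-refl free
    where
    free : ∀ n → Free (C₃.cyclicGraph κ n) (G₂ κ ∷ [])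
    free n F (here refl) = C₃.D₂-free 0<κ (colours<rootSize 3 (≤ᵇ⇒≤ 3 4 _))
      (from-yes (differ? (rotate 2 ∘ rotate 2 ∘ rotate 2) (rotate 2)))

  G₃-coex≥5/16 : EventuallyCoexAtLeast (suc κ) (G₃ κ ∷ []) 5 16
  G₃-coex≥5/16 = C₂.cyclicRate κ (G₃ κ ∷ []) 5 16 2≤κ (≤ᵇ⇒≤ 11 16 _) free
    where
    free : ∀ n → Free (C₂.cyclicGraph κ n) (G₃ κ ∷ [])
    free n F (here refl) = C₂.D₃-free 0<κ (colours<rootSize 2 (≤ᵇ⇒≤ 2 4 _))
      (from-yes (differ? (rotate 1 ∘ rotate 1 ∘ rotate 1 ∘ rotate 1) (rotate 1)))

theorem1p3 : (k : ℕ) → 3 ≤ k →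
    ∃[ F₁ ] ∃[ F₂ ]
      -- 0 < γ({F₁,F₂}) : some rational rate a/b > 0 is eventually attained
      ((∃[ a ] ∃[ b ] (0 < a × 0 < b ×
          EventuallyCoexAtLeast k (F₁ ∷ F₂ ∷ []) a b)) ×
      -- γ({F₁,F₂}) ≤ a/b < c/d ≤ min{γ(F₁),γ(F₂)}
       (∃[ a ] ∃[ b ] ∃[ c ] ∃[ d ] (0 < b × 0 < d × a * d < c * b ×
          EventuallyCoexAtMost k (F₁ ∷ F₂ ∷ []) a b ×
          EventuallyCoexAtLeast k (F₁ ∷ []) c d ×
          EventuallyCoexAtLeast k (F₂ ∷ []) c d)))
theorem1p3 (suc κ) (s≤s 2≤κ) =
  G₂ κ , G₃ κ ,
  (1 , 5 , s≤s z≤n , s≤s z≤n , G₂G₃-coex≥1/5 2≤κ) ,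
  -- The two rates are separated by `3 * 16 < 5 * 10`.
  (3 , 10 , 5 , 16 , s≤s z≤n , s≤s z≤n , ≤ᵇ⇒≤ 49 50 _ ,
    G₂G₃-coex≤3/10 κ , G₂-coex≥5/16 2≤κ , G₃-coex≥5/16 2≤κ)
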